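{- For a collection of jobs with relative laxities in the range $[\lambda_1,\lambda_2]\subseteq(0,1/2]$, Shortest Job First is $O\left(\log_{1/\lambda_2}\frac{\lambda_2}{\lambda_1}\right)$-machine optimal, for any $\lambda_1,\lambda_2$.
   Context: Jobs and schedules. An instance is a finite set of jobs arriving over time; each job $j$ has an integer release time $r_j$ (when the online scheduler learns of it), an integer size $p_j$ and an integer deadline $d_j$. Its lifespan is the interval $I(j)=(r_j,d_j)$ of length $|I(j)|=d_j-r_j$, its laxity is $\ell_j=d_j-r_j-p_j$, and its relative laxity is $\rho_j=\ell_j/|I(j)|$. Jobs are scheduled on identical machines, preemptively and with migration allowed: each machine processes at most one job at a time, and no job is processed on two machines at the same time. A job $j$ completes when it has been processed for $p_j$ units of time. A schedule is feasible if every job completes within its lifespan. Shortest Job First (SJF) on $M$ machines: at each time, among the jobs that have been released and are not yet completed, process the (up to) $M$ jobs with smallest original size $p_j$. An algorithm is $c$-machine optimal if it feasibly schedules a collection of jobs on $c\cdot m$ machines whenever there exists a feasible schedule of that collection on $m$ machines.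
   Formalization: The bounds λ₁, λ₂ are rational and schedules switch jobs only at multiples of some 1/N; the O-bound is read as at most C·(1 + log_{1/λ₂}(λ₂/λ₁)) with an absolute constant C, since without the 1 it would give zero machines when λ₁ = λ₂. -}

module Defs where

open import Algebra.Definitions.RawSemiring using (_^_)
open import Data.Bool.Base using (if_then_else_)
open import Data.Fin.Base using (Fin)
open import Data.Fin.Properties using (any?) renaming (_≟_ to _≟ᶠ_)
open import Data.Integer.Base as ℤ using (ℤ; +_)
open import Data.Maybe.Base using (Maybe; just)
open import Data.Maybe.Properties using (≡-dec)
open import Data.Nat.Base using (ℕ; zero; suc; _*_; _∸_; _≤_; _<_; NonZero; >-nonZero)
open import Data.Nat.Properties using (m<n⇒0<n∸m)
open import Data.Product.Base using (∃-syntax; _×_)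
open import Data.Rational.Base as ℚ using (ℚ; +-*-rawSemiring)
open import Data.Vec.Functional using (Vector)
open import Relation.Binary.PropositionalEquality.Core using (_≡_)
open import Relation.Nullary using (¬_; Dec; does)

record Job : Set where
  field
    release size deadline : ℕ
    release<deadline      : release < deadline

  lifespanLength : ℕ
  lifespanLength = deadline ∸ release

  laxity : ℤ
  laxity = + deadline ℤ.- + release ℤ.- + size

  relLaxity : ℚ
  relLaxity = (laxity ℚ./ lifespanLength) {{>-nonZero (m<n⇒0<n∸m release<deadline)}}

open Job public

Instance : ℕ → Set
Instance n = Vector Job n

-- A preemptive, migratory schedule of n jobs on M machines whose preemption
-- times are rational: with N = resolution a common denominator of these times,
-- slot k is the time interval [k/N , (k+1)/N), during which every machine
-- works on at most one fixed job.  An integer time t is the start of slot t * N,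
-- and p units of processing are p * N slots.
record Schedule (n M : ℕ) : Set where
  field
    resolution         : ℕ
    {{resolution≢0}}   : NonZero resolution
    assign             : ℕ → Fin M → Maybe (Fin n)
    oneMachineAtATime  : ∀ k {i i′ j} → assign k i ≡ just j → assign k i′ ≡ just j → i ≡ i′

  Runs : ℕ → Fin n → Set
  Runs k j = ∃[ i ] assign k i ≡ just j

  runs? : ∀ k j → Dec (Runs k j)
  runs? k j = any? λ i → ≡-dec _≟ᶠ_ (assign k i) (just j)

  -- number of slots before slot k in which j is processed
  slotsBefore : ℕ → Fin n → ℕ
  slotsBefore zero    j = zero
  slotsBefore (suc k) j =
    if does (runs? k j) then suc (slotsBefore k j) else slotsBefore k j

  Released : Instance n → ℕ → Fin n → Set
  Released J k j = release (J j) * resolution ≤ k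

  Completed : Instance n → ℕ → Fin n → Set
  Completed J k j = size (J j) * resolution ≤ slotsBefore k j

open Schedule public

Feasible : ∀ {n M} → Instance n → Schedule n M → Set
Feasible J S = ∀ j → (∀ k → Runs S k j → Released S J k j)
                   × Completed S J (deadline (J j) * resolution S) j

-- An algorithm is given by its possible runs on an instance; there may be
-- several because of ties.
Algorithm : Set₁
Algorithm = ∀ {n M} → Instance n → Schedule n M → Set

-- Every way of breaking ties is allowed, and ties may be broken differently in
-- different slots.
SJF : Algorithm
SJF J S = ∀ k →
    (∀ j → Runs S k j → Available k j)
  × (∀ j → Available k j → ¬ Runs S k j →
       ∀ i → ∃[ j′ ] assign S k i ≡ just j′ × size (J j′) ≤ size (J j))
  where
  Available : ℕ → Fin _ → Set
  Available k j = Released S J k j × ¬ Completed S J k j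

-- The first component excludes vacuous success of an algorithm without runs.
FeasiblySchedules : Algorithm → ∀ {n} → Instance n → ℕ → Set
FeasiblySchedules A {n} J M =
    (∃[ S ] A {n} {M} J S)
  × (∀ (S : Schedule n M) → A J S → Feasible J S)

MachineOptimal : Algorithm → (Job → Set) → ℕ → Set
MachineOptimal A P c =
  ∀ {n} (J : Instance n) → (∀ j → P (J j)) →
  ∀ m → (∃[ S ] Feasible {n} {m} J S) → FeasiblySchedules A J (c * m)

RelLaxityIn : ℚ → ℚ → Job → Set
RelLaxityIn λ₁ λ₂ j = λ₁ ℚ.≤ relLaxity j × relLaxity j ℚ.≤ λ₂

-- For b > 1 and x > 0 this is the real inequality c ≤ C · (1 + log_b x):
-- since 1 + log_b x = log_b (b x), it says b ^ c ≤ (b x) ^ C.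
_≤_·[1+log[_]_] : ℕ → ℕ → ℚ → ℚ → Set
c ≤ C ·[1+log[ b ] x ] = (b ^ℚ c) ℚ.≤ ((b ℚ.* x) ^ℚ C)
  where
  _^ℚ_ : ℚ → ℕ → ℚ
  _^ℚ_ = _^_ +-*-rawSemiring

{-# OPTIONS --safe #-}
-- Put K = ⌊1/λ₂⌋ ≥ 2.  A job that SJF on 63km machines does not run, although it
-- is available, sees 63km jobs that are no larger, hence (relative laxities are
-- at most 1/2) of lifespan at most twice its own.  As all jobs of earlier
-- deadline have met it, these jobs are alive.  So it suffices that in a window of
-- length L at most L / K^k units of time see 63km alive jobs of lifespan ≤ L.
--
-- For k = 1: a job runs in the optimal schedule during all but a 1/K fraction of
-- its lifespan, so at most m alive jobs are explained by running jobs, and the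
-- idle time of the others adds up to O(mL/K).  The bound for k + 1 follows by
-- bisection of the window (a dyadic John–Nirenberg argument): stop at a piece of
-- length s as soon as 31m jobs of lifespan ≥ Ks meet it.  The stopped pieces
-- cover at most L/K by the case k = 1, where lifespans are enlarged by 1/K on
-- either side so that every long job meeting a piece counts on all of it.  Inside
-- a stopped piece fewer than 31m alive jobs have lifespan ≥ 2Ks, and at most 32m
-- have lifespan in (s, 2Ks), since those run for s/2 near the piece.  The other
-- 63km of 63(k+1)m have lifespan ≤ s, so the bound for k applies.
module Submission where

open import Defs
open import Data.Bool.Base using (if_then_else_)
open import Data.Fin.Base using (Fin; zero; suc)
open import Data.Fin.Properties using (any?; suc-injective) renaming (_≟_ to _≟ᶠ_)
import Data.Integer.Base as ℤ
import Data.Integer.Properties as ℤ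
open import Data.Maybe.Base using (Maybe; just; nothing)
open import Data.Maybe.Properties using (≡-dec; just-injective)
open import Data.Nat.Base
open import Data.Nat.Coprimality using (Coprime)
open import Data.Nat.DivMod using (m≡m%n+[m/n]*n; m%n<n; m/n*n≤m; m*n/n≡m; m/n≤m; /-monoˡ-≤)
open import Data.Nat.Properties hiding (suc-injective)
open import Data.Nat.Tactic.RingSolver using (solve-∀)
open import Data.Product.Base using (∃-syntax; _×_; _,_; proj₁; proj₂)
open import Data.Rational.Base as ℚ using (ℚ; mkℚ; Positive; ½; 1/_; _÷_; toℚᵘ; ↥_; ↧_; *≤*)
open import Data.Rational.Properties as ℚ using (pos⇒nonZero; pos⇒nonNeg; 1/pos⇒pos)
open import Data.Rational.Unnormalised.Base as ℚᵘ using (mkℚᵘ)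
import Data.Rational.Unnormalised.Properties as ℚᵘ
open import Data.Sum.Base using (_⊎_; inj₁; inj₂; [_,_]′)
open import Function.Base using (_∘_; _$_)
open import Relation.Binary.PropositionalEquality
open import Relation.Nullary using (¬_; Dec; yes; no; does; contradiction; toSum; ¬?; _×-dec_; _⊎-dec_)

open import Algebra.Definitions.RawSemiring ℚ.+-*-rawSemiring using () renaming (_^_ to _^ℚ_)
open import Algebra.Properties.Semiring.Sum +-*-semiring
  using (sum; sum-cong-≗; sum-replicate-zero; ∑-distrib-+; ∑-comm; *-distribˡ-sum)

private variable
  n : ℕ
  P Q R : Set

-- A linear inequality a ≤ b follows from x ≤ y and the identity a + y + s = b + x,
-- which is within reach of the semiring solver.
≤-by : ∀ {a b x y} s → x ≤ y → a + y + s ≡ b + x → a ≤ b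
≤-by {a} {b} {x} {y} s x≤y eq = +-cancelʳ-≤ y a b $ begin
  a + y      ≤⟨ m≤m+n (a + y) s ⟩
  a + y + s  ≡⟨ eq ⟩
  b + x      ≤⟨ +-monoʳ-≤ b x≤y ⟩
  b + y      ∎
  where open ≤-Reasoning

-- Indicators and counting over finite sets

𝟙 : Dec P → ℕ
𝟙 P? = if does P? then 1 else 0

𝟙≤1 : (P? : Dec P) → 𝟙 P? ≤ 1
𝟙≤1 (yes _) = ≤-refl
𝟙≤1 (no _)  = z≤n

𝟙-yes : (P? : Dec P) → P → 1 ≤ 𝟙 P?
𝟙-yes (yes _) _ = ≤-refl
𝟙-yes (no ¬p) p = contradiction p ¬p

𝟙-no : (P? : Dec P) → ¬ P → 𝟙 P? ≡ 0
𝟙-no (yes p) ¬p = contradiction p ¬p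
𝟙-no (no _)  _  = refl

𝟙-mono : (P? : Dec P) (Q? : Dec Q) → (P → Q) → 𝟙 P? ≤ 𝟙 Q?
𝟙-mono (yes p) Q? P⇒Q = 𝟙-yes Q? (P⇒Q p)
𝟙-mono (no _)  Q? P⇒Q = z≤n

𝟙-⊎ : (P? : Dec P) (Q? : Dec Q) (R? : Dec R) → (P → Q ⊎ R) → 𝟙 P? ≤ 𝟙 Q? + 𝟙 R?
𝟙-⊎ (no _)  Q? R? P⇒Q⊎R = z≤n
𝟙-⊎ (yes p) Q? R? P⇒Q⊎R with P⇒Q⊎R p
... | inj₁ q = ≤-trans (𝟙-yes Q? q) (m≤m+n _ _)
... | inj₂ r = ≤-trans (𝟙-yes R? r) (m≤n+m _ _)

𝟙-*-≤ : (P? : Dec P) {x y : ℕ} → (P → x ≤ y) → 𝟙 P? * x ≤ y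
𝟙-*-≤ (yes p) x≤y = ≤-trans (≤-reflexive (*-identityˡ _)) (x≤y p)
𝟙-*-≤ (no _)  _   = z≤n

sum-mono : {f g : Fin n → ℕ} → (∀ i → f i ≤ g i) → sum f ≤ sum g
sum-mono {n = zero}  f≤g = z≤n
sum-mono {n = suc n} f≤g = +-mono-≤ (f≤g zero) (sum-mono (f≤g ∘ suc))

sum-≤* : ∀ {c} {f : Fin n → ℕ} → (∀ i → f i ≤ c) → sum f ≤ n * c
sum-≤* {n = zero}  f≤c = z≤n
sum-≤* {n = suc n} f≤c = +-mono-≤ (f≤c zero) (sum-≤* (f≤c ∘ suc))

sum-zero : {f : Fin n → ℕ} → (∀ i → f i ≡ 0) → sum f ≡ 0
sum-zero {n} f≡0 = trans (sum-cong-≗ f≡0) (sum-replicate-zero n)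

sum-1 : ∀ n → sum {n} (λ _ → 1) ≡ n
sum-1 zero    = refl
sum-1 (suc n) = cong suc (sum-1 n)

term≤sum : (f : Fin n → ℕ) → ∀ i → f i ≤ sum f
term≤sum f zero    = m≤m+n _ _
term≤sum f (suc i) = ≤-trans (term≤sum (f ∘ suc) i) (m≤n+m _ _)

card : {P : Fin n → Set} → (∀ i → Dec (P i)) → ℕ
card P? = sum (λ i → 𝟙 (P? i))

card-mono : {P Q : Fin n → Set} (P? : ∀ i → Dec (P i)) (Q? : ∀ i → Dec (Q i)) →
            (∀ i → P i → Q i) → card P? ≤ card Q?
card-mono P? Q? P⇒Q = sum-mono λ i → 𝟙-mono (P? i) (Q? i) (P⇒Q i)

card-⊎ : {P Q R : Fin n → Set} (P? : ∀ i → Dec (P i)) (Q? : ∀ i → Dec (Q i)) (R? : ∀ i → Dec (R i)) →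
         (∀ i → P i → Q i ⊎ R i) → card P? ≤ card Q? + card R?
card-⊎ P? Q? R? P⇒Q⊎R = ≤-trans
  (sum-mono λ i → 𝟙-⊎ (P? i) (Q? i) (R? i) (P⇒Q⊎R i))
  (≤-reflexive (∑-distrib-+ (λ i → 𝟙 (Q? i)) (λ i → 𝟙 (R? i))))

card≤1 : {P : Fin n → Set} (P? : ∀ i → Dec (P i)) → (∀ {i j} → P i → P j → i ≡ j) → card P? ≤ 1
card≤1 {n = zero}  P? unique = z≤n
card≤1 {n = suc n} P? unique with P? zero
... | no _  = card≤1 (P? ∘ suc) λ p q → suc-injective (unique p q)
... | yes p = ≤-reflexive (cong suc (sum-zero λ i → 𝟙-no (P? (suc i)) λ q → contradiction (unique p q) λ ()))

card-zero : {P : Fin n → Set} (P? : ∀ i → Dec (P i)) → (∀ i → ¬ P i) → card P? ≡ 0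
card-zero P? ¬P = sum-zero λ i → 𝟙-no (P? i) (¬P i)

-- Sums over time and half-open intervals

∑< : ℕ → (ℕ → ℕ) → ℕ
∑< zero    f = 0
∑< (suc n) f = ∑< n f + f n

∑<-mono : ∀ n {f g} → (∀ t → t < n → f t ≤ g t) → ∑< n f ≤ ∑< n g
∑<-mono zero    f≤g = z≤n
∑<-mono (suc n) f≤g = +-mono-≤ (∑<-mono n λ t t<n → f≤g t (m<n⇒m<1+n t<n)) (f≤g n ≤-refl)

∑<-cong : ∀ n {f g} → (∀ t → t < n → f t ≡ g t) → ∑< n f ≡ ∑< n g
∑<-cong zero    f≡g = refl
∑<-cong (suc n) f≡g = cong₂ _+_ (∑<-cong n λ t t<n → f≡g t (m<n⇒m<1+n t<n)) (f≡g n ≤-refl)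

∑<-const : ∀ n c → ∑< n (λ _ → c) ≡ n * c
∑<-const zero    c = refl
∑<-const (suc n) c = trans (cong (_+ c) (∑<-const n c)) (+-comm (n * c) c)

∑<-distrib-+ : ∀ n f g → ∑< n (λ t → f t + g t) ≡ ∑< n f + ∑< n g
∑<-distrib-+ zero    f g = refl
∑<-distrib-+ (suc n) f g = trans (cong (_+ (f n + g n)) (∑<-distrib-+ n f g)) (interchange (∑< n f) (∑< n g) (f n) (g n))
  where
  interchange : ∀ a b c d → (a + b) + (c + d) ≡ (a + c) + (b + d)
  interchange = solve-∀

*-distribˡ-∑< : ∀ n c f → c * ∑< n f ≡ ∑< n (λ t → c * f t)
*-distribˡ-∑< zero    c f = *-zeroʳ c
*-distribˡ-∑< (suc n) c f = trans (*-distribˡ-+ c (∑< n f) (f n)) (cong (_+ c * f n) (*-distribˡ-∑< n c f))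

∑<-split : ∀ a b f → ∑< (a + b) f ≡ ∑< a f + ∑< b (λ t → f (a + t))
∑<-split a zero    f = trans (cong (λ x → ∑< x f) (+-identityʳ a)) (sym (+-identityʳ _))
∑<-split a (suc b) f = begin
  ∑< (a + suc b) f                                 ≡⟨ cong (λ x → ∑< x f) (+-suc a b) ⟩
  ∑< (a + b) f + f (a + b)                         ≡⟨ cong (_+ f (a + b)) (∑<-split a b f) ⟩
  ∑< a f + ∑< b (λ t → f (a + t)) + f (a + b)      ≡⟨ +-assoc (∑< a f) _ _ ⟩
  ∑< a f + (∑< b (λ t → f (a + t)) + f (a + b))    ∎
  where open ≡-Reasoning

∑<-monoˡ : ∀ {a b} → a ≤ b → ∀ f → ∑< a f ≤ ∑< b f
∑<-monoˡ {a} a≤b f with _ , refl ← m≤n⇒∃[o]m+o≡n a≤b =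
  ≤-trans (m≤m+n _ _) (≤-reflexive (sym (∑<-split a _ f)))

∑<-blocks : ∀ a b f → ∑< (a * b) f ≡ ∑< a (λ t → ∑< b (λ i → f (t * b + i)))
∑<-blocks zero    b f = refl
∑<-blocks (suc a) b f = begin
  ∑< (b + a * b) f                                          ≡⟨ cong (λ x → ∑< x f) (+-comm b (a * b)) ⟩
  ∑< (a * b + b) f                                          ≡⟨ ∑<-split (a * b) b f ⟩
  ∑< (a * b) f + ∑< b (λ i → f (a * b + i))
    ≡⟨ cong (_+ ∑< b (λ i → f (a * b + i))) (∑<-blocks a b f) ⟩
  ∑< (suc a) (λ t → ∑< b (λ i → f (t * b + i)))             ∎
  where open ≡-Reasoning

∑<-sum-comm : ∀ H (f : Fin n → ℕ → ℕ) → ∑< H (λ t → sum (λ j → f j t)) ≡ sum (λ j → ∑< H (f j))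
∑<-sum-comm {n} zero f = sym (sum-replicate-zero n)
∑<-sum-comm (suc H) f = trans (cong (_+ sum (λ j → f j H)) (∑<-sum-comm H f)) (sym (∑-distrib-+ (λ j → ∑< H (f j)) (λ j → f j H)))

In : ℕ → ℕ → ℕ → Set
In a b t = a ≤ t × t < b

in? : ∀ a b t → Dec (In a b t)
in? a b t = (a ≤? t) ×-dec (t <? b)

∑<-in-≤ : ∀ H a b → ∑< H (λ t → 𝟙 (in? a b t)) ≤ b ∸ a
∑<-in-≤ zero    a b = z≤n
∑<-in-≤ (suc H) a b with suc H ≤? b
... | no 1+H≰b = begin
  ∑< H (λ t → 𝟙 (in? a b t)) + 𝟙 (in? a b H)
    ≡⟨ cong (∑< H (λ t → 𝟙 (in? a b t)) +_) (𝟙-no (in? a b H) (1+H≰b ∘ proj₂)) ⟩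
  ∑< H (λ t → 𝟙 (in? a b t)) + 0              ≡⟨ +-identityʳ _ ⟩
  ∑< H (λ t → 𝟙 (in? a b t))                  ≤⟨ ∑<-in-≤ H a b ⟩
  b ∸ a                                       ∎
  where open ≤-Reasoning
... | yes 1+H≤b = begin
  ∑< (suc H) (λ t → 𝟙 (in? a b t))  ≤⟨ ∑<-mono (suc H) (λ t _ → 𝟙-mono (in? a b t) (a ≤? t) proj₁) ⟩
  ∑< (suc H) (λ t → 𝟙 (a ≤? t))     ≤⟨ from (suc H) ⟩
  suc H ∸ a                         ≤⟨ ∸-monoˡ-≤ a 1+H≤b ⟩
  b ∸ a                             ∎
  where
  open ≤-Reasoning
  from : ∀ H → ∑< H (λ t → 𝟙 (a ≤? t)) ≤ H ∸ a
  from zero    = z≤n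
  from (suc H) with a ≤? H
  ... | yes a≤H = begin
    ∑< (suc H) (λ t → 𝟙 (a ≤? t))  ≤⟨ +-mono-≤ (from H) (𝟙≤1 (a ≤? H)) ⟩
    H ∸ a + 1                    ≡⟨ +-comm (H ∸ a) 1 ⟩
    suc (H ∸ a)                  ≡⟨ +-∸-assoc 1 a≤H ⟨
    suc H ∸ a                    ∎
  ... | no a≰H = begin
    ∑< (suc H) (λ t → 𝟙 (a ≤? t))  ≡⟨ cong (∑< H (λ t → 𝟙 (a ≤? t)) +_) (𝟙-no (a ≤? H) a≰H) ⟩
    ∑< H (λ t → 𝟙 (a ≤? t)) + 0  ≡⟨ +-identityʳ _ ⟩
    ∑< H (λ t → 𝟙 (a ≤? t))      ≤⟨ from H ⟩
    H ∸ a                        ≤⟨ ∸-monoˡ-≤ a (n≤1+n H) ⟩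
    suc H ∸ a                    ∎

-- Moves a window to the common time axis up to `H`, where it becomes an indicator weight and sums
-- over time and over jobs can be exchanged.
window≤∑< : ∀ {H} a l (f : ℕ → ℕ) → a + l ≤ H → ∑< l (λ t → f (a + t)) ≤ ∑< H (λ t → 𝟙 (in? a (a + l) t) * f t)
window≤∑< {H} a l f a+l≤H = begin
  ∑< l (λ t → f (a + t))                                      ≤⟨ ∑<-mono l (λ t t<l → on t t<l) ⟩
  ∑< l (λ t → 𝟙 (in? a (a + l) (a + t)) * f (a + t))          ≤⟨ m≤n+m _ _ ⟩
  ∑< a g + ∑< l (λ t → g (a + t))                             ≡⟨ ∑<-split a l g ⟨
  ∑< (a + l) g                                                ≤⟨ ∑<-monoˡ a+l≤H g ⟩
  ∑< H g                                                      ∎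
  where
  open ≤-Reasoning
  g : ℕ → ℕ
  g t = 𝟙 (in? a (a + l) t) * f t
  on : ∀ t → t < l → f (a + t) ≤ g (a + t)
  on t t<l = begin
    f (a + t)      ≡⟨ *-identityˡ (f (a + t)) ⟨
    1 * f (a + t)  ≤⟨ *-monoˡ-≤ (f (a + t)) (𝟙-yes (in? a (a + l) (a + t)) (m≤m+n a t , +-monoʳ-< a t<l)) ⟩
    g (a + t)      ∎

-- Crowding in a feasible schedule

-- w j t / N is the amount of work a feasible schedule on m machines does on job j
-- during the unit of time [t , t + 1).
module Core {n} (J : Instance n) (m N K : ℕ) {{_ : NonZero m}} {{_ : NonZero N}} {{_ : NonZero K}} (2≤K : 2 ≤ K)
  (slack : Fin n → ℕ)
  (size+slack : ∀ j → size (J j) + slack j ≡ lifespanLength (J j))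
  (K*slack≤len : ∀ j → K * slack j ≤ lifespanLength (J j))
  (slack≢0 : ∀ j → NonZero (slack j))
  (w : Fin n → ℕ → ℕ)
  (w≤alive : ∀ j t → w j t ≤ N * 𝟙 (in? (release (J j)) (deadline (J j)) t))
  (w-capacity : ∀ t → sum (λ j → w j t) ≤ m * N)
  (w-total : ∀ j → size (J j) * N ≤ ∑< (deadline (J j)) (w j))
  where

  r d p len : Fin n → ℕ
  r j = release (J j)
  d j = deadline (J j)
  p j = size (J j)
  len j = lifespanLength (J j)

  Alive : ℕ → Fin n → Set
  Alive t j = In (r j) (d j) t

  alive? : ∀ t j → Dec (Alive t j)
  alive? t j = in? (r j) (d j) t

  r+len : ∀ j → r j + len j ≡ d j
  r+len j = m+[n∸m]≡n (<⇒≤ (release<deadline (J j)))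

  2*slack≤len : ∀ j → 2 * slack j ≤ len j
  2*slack≤len j = ≤-trans (*-monoˡ-≤ (slack j) 2≤K) (K*slack≤len j)

  horizon : ℕ
  horizon = sum d

  d≤horizon : ∀ j → d j ≤ horizon
  d≤horizon = term≤sum d

  processed : {X : ℕ → Set} → (∀ t → Dec (X t)) → ℕ → Fin n → ℕ
  processed X? H j = ∑< H (λ t → 𝟙 (X? t) * w j t)

  -- Over its whole lifespan job `j` idles for at most `slack j` units, so it cannot idle longer
  -- than that within any set `X` of times.
  processed-≥ : ∀ {X : ℕ → Set} (X? : ∀ t → Dec (X t)) {H} j → d j ≤ H →
    N * ∑< H (λ t → 𝟙 (X? t) * 𝟙 (alive? t j)) ≤ processed X? H j + N * slack j
  processed-≥ X? {H} j d≤H = ≤-by 0 chain (arith (N * A) (processed X? H j) N (p j) (slack j))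
    where
    open ≤-Reasoning
    A = ∑< H (λ t → 𝟙 (X? t) * 𝟙 (alive? t j))
    arith : ∀ x P N p s → x + (P + N * (p + s)) + 0 ≡ P + N * s + (x + p * N)
    arith = solve-∀
    -- On `X` the two sides are equal; off `X` only `w≤alive` remains.
    pointwise : ∀ {X : Set} (X? : Dec X) {v i} → v ≤ N * i → N * (𝟙 X? * i) + v ≤ 𝟙 X? * v + N * i
    pointwise (yes _) {v} {i} _   = ≤-reflexive (identity N v i)
      where
      identity : ∀ N v i → N * (1 * i) + v ≡ 1 * v + N * i
      identity = solve-∀
    pointwise (no _)  {v} v≤Ni = ≤-trans (≤-reflexive (cong (_+ v) (*-zeroʳ N))) v≤Ni
    chain : N * A + p j * N ≤ processed X? H j + N * (p j + slack j)
    chain = begin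
      N * A + p j * N
        ≤⟨ +-monoʳ-≤ (N * A) (≤-trans (w-total j) (∑<-monoˡ d≤H (w j))) ⟩
      N * A + ∑< H (w j)
        ≡⟨ cong (_+ ∑< H (w j)) (*-distribˡ-∑< H N _) ⟩
      ∑< H (λ t → N * (𝟙 (X? t) * 𝟙 (alive? t j))) + ∑< H (w j)
        ≡⟨ ∑<-distrib-+ H _ _ ⟨
      ∑< H (λ t → N * (𝟙 (X? t) * 𝟙 (alive? t j)) + w j t)
        ≤⟨ ∑<-mono H (λ t _ → pointwise (X? t) (w≤alive j t)) ⟩
      ∑< H (λ t → 𝟙 (X? t) * w j t + N * 𝟙 (alive? t j))
        ≡⟨ ∑<-distrib-+ H _ _ ⟩
      processed X? H j + ∑< H (λ t → N * 𝟙 (alive? t j))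
        ≡⟨ cong (processed X? H j +_) (*-distribˡ-∑< H N _) ⟨
      processed X? H j + N * ∑< H (λ t → 𝟙 (alive? t j))
        ≤⟨ +-monoʳ-≤ (processed X? H j) (*-monoʳ-≤ N (∑<-in-≤ H (r j) (d j))) ⟩
      processed X? H j + N * len j
        ≡⟨ cong (λ x → processed X? H j + N * x) (size+slack j) ⟨
      processed X? H j + N * (p j + slack j) ∎

  processed-window-≥ : ∀ {X : ℕ → Set} (X? : ∀ t → Dec (X t)) {H} j → d j ≤ H →
    ∀ a l → r j ≤ a → a + l ≤ d j → (∀ t → In a (a + l) t → X t) →
    N * l ≤ processed X? H j + N * slack j
  processed-window-≥ X? {H} j d≤H a l r≤a a+l≤d ⊆X = ≤-trans (*-monoʳ-≤ N l≤) (processed-≥ X? j d≤H)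
    where
    open ≤-Reasoning
    l≤ : l ≤ ∑< H (λ t → 𝟙 (X? t) * 𝟙 (alive? t j))
    l≤ = begin
      l                                                   ≡⟨ *-identityʳ l ⟨
      l * 1                                               ≡⟨ ∑<-const l 1 ⟨
      ∑< l (λ _ → 1)                                      ≤⟨ window≤∑< a l (λ _ → 1) (≤-trans a+l≤d d≤H) ⟩
      ∑< H (λ t → 𝟙 (in? a (a + l) t) * 1)                ≤⟨ ∑<-mono H (λ t _ → 𝟙-*-≤ (in? a (a + l) t) (both t)) ⟩
      ∑< H (λ t → 𝟙 (X? t) * 𝟙 (alive? t j))              ∎
      where
      both : ∀ t → In a (a + l) t → 1 ≤ 𝟙 (X? t) * 𝟙 (alive? t j)
      both t (a≤t , t<a+l) = *-mono-≤ (𝟙-yes (X? t) (⊆X t (a≤t , t<a+l)))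
        (𝟙-yes (alive? t j) (≤-trans r≤a a≤t , <-≤-trans t<a+l a+l≤d))

  -- Since `2 ≤ K`, at most half of the lifespan is idle.
  processed-lifespan-≥ : ∀ {X : ℕ → Set} (X? : ∀ t → Dec (X t)) {H} j → d j ≤ H →
    (∀ t → Alive t j → X t) → N * len j ≤ 2 * processed X? H j
  processed-lifespan-≥ X? {H} j d≤H ⊆X = ≤-by 0 (+-mono-≤ (+-mono-≤ half half) (*-monoʳ-≤ N (2*slack≤len j)))
    (arith N (len j) (processed X? H j) (slack j))
    where
    half = processed-window-≥ X? {H} j d≤H (r j) (len j) ≤-refl (≤-reflexive (r+len j))
      (λ t (r≤t , t<) → ⊆X t (r≤t , subst (t <_) (r+len j) t<))
    arith : ∀ N l P s → N * l + (P + N * s + (P + N * s) + N * l) + 0 ≡ 2 * P + (N * l + N * l + N * (2 * s))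
    arith = solve-∀

  ∑-processed-≤ : ∀ {X : ℕ → Set} (X? : ∀ t → Dec (X t)) H →
    sum (processed X? H) ≤ m * N * ∑< H (λ t → 𝟙 (X? t))
  ∑-processed-≤ X? H = begin
    sum (processed X? H)                               ≡⟨ ∑<-sum-comm H (λ j t → 𝟙 (X? t) * w j t) ⟨
    ∑< H (λ t → sum (λ j → 𝟙 (X? t) * w j t))          ≤⟨ ∑<-mono H (λ t _ → pointwise t) ⟩
    ∑< H (λ t → m * N * 𝟙 (X? t))                      ≡⟨ *-distribˡ-∑< H (m * N) _ ⟨
    m * N * ∑< H (λ t → 𝟙 (X? t))                      ∎
    where
    open ≤-Reasoning
    pointwise : ∀ t → sum (λ j → 𝟙 (X? t) * w j t) ≤ m * N * 𝟙 (X? t)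
    pointwise t = begin
      sum (λ j → 𝟙 (X? t) * w j t)   ≡⟨ *-distribˡ-sum (𝟙 (X? t)) (λ j → w j t) ⟨
      𝟙 (X? t) * sum (λ j → w j t)   ≤⟨ *-monoʳ-≤ (𝟙 (X? t)) (w-capacity t) ⟩
      𝟙 (X? t) * (m * N)             ≡⟨ *-comm (𝟙 (X? t)) (m * N) ⟩
      m * N * 𝟙 (X? t)               ∎

  -- Alive jobs of intermediate lifespan

  Mid : ℕ → ℕ → Fin n → Set
  Mid s t j = Alive t j × s < len j × len j < K * (2 * s)

  mid? : ∀ s t j → Dec (Mid s t j)
  mid? s t j = alive? t j ×-dec (s <? len j) ×-dec (len j <? K * (2 * s))

  -- Each such job receives at least `s / 2` units of work within distance `8 * s` of `t`. On this
  -- window, of length at most `16 * s`, the capacity of `m` machines admits only `32 * m` of them.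
  card-mid : ∀ s {{_ : NonZero s}} t → card (mid? s t) ≤ 32 * m
  card-mid s t = *-cancelˡ-≤ (N * s) {{m*n≢0 N s}} $ begin
    N * s * card (mid? s t)
      ≡⟨ *-distribˡ-sum (N * s) (λ j → 𝟙 (mid? s t j)) ⟩
    sum (λ j → N * s * 𝟙 (mid? s t j))
      ≤⟨ sum-mono (λ j → ≤-trans (≤-reflexive (*-comm (N * s) _)) (𝟙-*-≤ (mid? s t j) (half j))) ⟩
    sum (λ j → 2 * processed X? H j)
      ≡⟨ *-distribˡ-sum 2 (processed X? H) ⟨
    2 * sum (processed X? H)
      ≤⟨ *-monoʳ-≤ 2 (∑-processed-≤ X? H) ⟩
    2 * (m * N * ∑< H (λ τ → 𝟙 (X? τ)))
      ≤⟨ *-monoʳ-≤ 2 (*-monoʳ-≤ (m * N) (≤-trans (∑<-in-≤ H (t ∸ 8 * s) (t + 8 * s)) width)) ⟩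
    2 * (m * N * (16 * s))
      ≡⟨ arith m N s ⟩
    N * s * (32 * m) ∎
    where
    open ≤-Reasoning
    H = horizon
    X? : ∀ τ → Dec (In (t ∸ 8 * s) (t + 8 * s) τ)
    X? = in? (t ∸ 8 * s) (t + 8 * s)
    arith : ∀ m N s → 2 * (m * N * (16 * s)) ≡ N * s * (32 * m)
    arith = solve-∀
    -- Truncation at time 0 can only shorten the window.
    width : t + 8 * s ∸ (t ∸ 8 * s) ≤ 16 * s
    width = m≤n+o⇒m∸n≤o (t + 8 * s) (t ∸ 8 * s) $ begin
      t + 8 * s                       ≤⟨ +-monoˡ-≤ (8 * s) (m≤n+m∸n t (8 * s)) ⟩
      8 * s + (t ∸ 8 * s) + 8 * s     ≡⟨ arith′ s (t ∸ 8 * s) ⟩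
      t ∸ 8 * s + 16 * s              ∎
      where
      arith′ : ∀ s x → 8 * s + x + 8 * s ≡ x + 16 * s
      arith′ = solve-∀
    long : ∀ j → slack j ≤ 2 * s → N * (8 * s) ≤ processed X? H j + N * slack j → N * s ≤ 2 * processed X? H j
    long j slack≤ 8s≤ = ≤-by (11 * (N * s)) (+-mono-≤ 8s≤′ 8s≤′) (arith′ N s (processed X? H j))
      where
      8s≤′ = ≤-trans 8s≤ (+-monoʳ-≤ (processed X? H j) (*-monoʳ-≤ N slack≤))
      arith′ : ∀ N s P → N * s + (P + N * (2 * s) + (P + N * (2 * s))) + 11 * (N * s) ≡ 2 * P + (N * (8 * s) + N * (8 * s))
      arith′ = solve-∀
    half : ∀ j → Mid s t j → N * s ≤ 2 * processed X? H j
    -- The lifespan contains the `8 * s` units after `t`, or those before `t`, or lies inside the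
    -- window. In the first two cases at most `2 * s` units are idle, as
    -- `K * slack j ≤ len j < K * (2 * s)`; in the third, half of a lifespan longer than `s` is
    -- processed.
    half j ((r≤t , t<d) , s<len , len<) with t + 8 * s ≤? d j | r j + 8 * s ≤? t
    ... | yes t+8s≤d | _ = long j slack≤2s (processed-window-≥ X? j (d≤horizon j) t (8 * s) r≤t t+8s≤d
            λ τ (t≤τ , τ<) → ≤-trans (m∸n≤m t (8 * s)) t≤τ , τ<)
      where slack≤2s = <⇒≤ (*-cancelˡ-< K (slack j) (2 * s) (≤-<-trans (K*slack≤len j) len<))
    ... | no _ | yes r+8s≤t = long j slack≤2s (processed-window-≥ X? j (d≤horizon j) (t ∸ 8 * s) (8 * s)
            (m+n≤o⇒m≤o∸n (r j) r+8s≤t) (≤-trans (≤-reflexive end) (<⇒≤ t<d))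
            λ τ (≤τ , τ<) → ≤τ , <-≤-trans τ< (≤-trans (≤-reflexive end) (m≤m+n t _)))
      where
      slack≤2s = <⇒≤ (*-cancelˡ-< K (slack j) (2 * s) (≤-<-trans (K*slack≤len j) len<))
      end : t ∸ 8 * s + 8 * s ≡ t
      end = m∸n+n≡m (m+n≤o⇒n≤o (r j) r+8s≤t)
    ... | no t+8s≰d | no r+8s≰t = ≤-trans (*-monoʳ-≤ N (<⇒≤ s<len)) (processed-lifespan-≥ X? j (d≤horizon j)
            λ τ (r≤τ , τ<d) → ≤-trans (m≤n+o⇒m∸n≤o t (8 * s) (≤-trans (<⇒≤ (≰⇒> r+8s≰t)) (≤-reflexive (+-comm (r j) _)))) r≤τ
                            , <-trans τ<d (≰⇒> t+8s≰d))

  -- Enlarging a lifespan by its K-th part on both sides absorbs the boundary effects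
  -- of the bisection at the price of twice as much idle time again.
  margin : Fin n → ℕ
  margin j = len j / K

  Near : ℕ → Fin n → Set
  Near t j = r j ≤ t + margin j × t < d j + margin j

  near? : ∀ t j → Dec (Near t j)
  near? t j = (r j ≤? t + margin j) ×-dec (t <? d j + margin j)

  Loose : ℕ → ℕ → Fin n → Set
  Loose L t j = len j ≤ L × Near t j

  loose? : ∀ L t j → Dec (Loose L t j)
  loose? L t j = (len j ≤? L) ×-dec near? t j

  crowded? : ∀ L t → Dec (31 * m ≤ card (loose? L t))
  crowded? L t = 31 * m ≤? card (loose? L t)

  margin≤len : ∀ j → margin j ≤ len j
  margin≤len j = m/n≤m (len j) K

  K*[slack+2*margin]≤3*len : ∀ j → K * (slack j + 2 * margin j) ≤ 3 * len j
  K*[slack+2*margin]≤3*len j = ≤-by 0 (+-mono-≤ (K*slack≤len j) (+-mono-≤ K*margin≤len K*margin≤len))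
    (arith K (slack j) (margin j) (len j))
    where
    K*margin≤len : K * margin j ≤ len j
    K*margin≤len = ≤-trans (≤-reflexive (*-comm K (margin j))) (m/n*n≤m (len j) K)
    arith : ∀ K s e l → K * (s + 2 * e) + (l + (l + l)) + 0 ≡ 3 * l + (K * s + (K * e + K * e))
    arith = solve-∀

  -- The enlargement adds at most `2 * margin j` units, which are charged as idle time on top of
  -- `processed-≥`.
  near-processed : ∀ {X : ℕ → Set} (X? : ∀ t → Dec (X t)) {H} j → d j ≤ H →
    N * ∑< H (λ t → 𝟙 (X? t) * 𝟙 (near? t j)) ≤ processed X? H j + N * (slack j + 2 * margin j)
  near-processed X? {H} j d≤H = begin
    N * ∑< H (λ t → 𝟙 (X? t) * 𝟙 (near? t j))
      ≤⟨ *-monoʳ-≤ N (∑<-mono H λ t _ → pointwise t) ⟩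
    N * ∑< H (λ t → 𝟙 (X? t) * 𝟙 (alive? t j) + (before t + after t))
      ≡⟨ cong (N *_) (trans (∑<-distrib-+ H during (λ t → before t + after t)) (cong (∑< H during +_) (∑<-distrib-+ H before after))) ⟩
    N * (∑< H (λ t → 𝟙 (X? t) * 𝟙 (alive? t j)) + (∑< H before + ∑< H after))
      ≤⟨ *-monoʳ-≤ N (+-monoʳ-≤ (∑< H _) (+-mono-≤ (≤-trans (∑<-in-≤ H (r j ∸ e) (r j)) r∸[r∸e]≤e)
                                                   (≤-trans (∑<-in-≤ H (d j) (d j + e)) (≤-reflexive (m+n∸m≡n (d j) e))))) ⟩
    N * (∑< H (λ t → 𝟙 (X? t) * 𝟙 (alive? t j)) + (e + e))
      ≡⟨ *-distribˡ-+ N _ (e + e) ⟩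
    N * ∑< H (λ t → 𝟙 (X? t) * 𝟙 (alive? t j)) + N * (e + e)
      ≤⟨ +-monoˡ-≤ (N * (e + e)) (processed-≥ X? j d≤H) ⟩
    processed X? H j + N * slack j + N * (e + e)
      ≡⟨ arith (processed X? H j) N (slack j) e ⟩
    processed X? H j + N * (slack j + 2 * e) ∎
    where
    open ≤-Reasoning
    e = margin j
    arith : ∀ P N s e → P + N * s + N * (e + e) ≡ P + N * (s + 2 * e)
    arith = solve-∀
    during before after : ℕ → ℕ
    during t = 𝟙 (X? t) * 𝟙 (alive? t j)
    before t = 𝟙 (in? (r j ∸ e) (r j) t)
    after  t = 𝟙 (in? (d j) (d j + e) t)
    r∸[r∸e]≤e : r j ∸ (r j ∸ e) ≤ e
    r∸[r∸e]≤e = m≤n+o⇒m∸n≤o (r j) (r j ∸ e) (≤-trans (m≤n+m∸n (r j) e) (≤-reflexive (+-comm e (r j ∸ e))))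
    pointwise : ∀ t → 𝟙 (X? t) * 𝟙 (near? t j) ≤ 𝟙 (X? t) * 𝟙 (alive? t j) + (before t + after t)
    pointwise t = begin
      𝟙 (X? t) * 𝟙 (near? t j)
        ≤⟨ *-monoʳ-≤ (𝟙 (X? t)) (𝟙-⊎ (near? t j) (alive? t j) (outside? t) split) ⟩
      𝟙 (X? t) * (𝟙 (alive? t j) + 𝟙 (outside? t))
        ≡⟨ *-distribˡ-+ (𝟙 (X? t)) _ _ ⟩
      𝟙 (X? t) * 𝟙 (alive? t j) + 𝟙 (X? t) * 𝟙 (outside? t)
        ≤⟨ +-monoʳ-≤ (𝟙 (X? t) * 𝟙 (alive? t j)) (≤-trans (𝟙-*-≤ (X? t) (λ _ → ≤-refl)) (𝟙-⊎ (outside? t) (in? (r j ∸ e) (r j) t) (in? (d j) (d j + e) t) λ x → x)) ⟩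
      𝟙 (X? t) * 𝟙 (alive? t j) + (before t + after t) ∎
      where
      outside? : ∀ t → Dec (In (r j ∸ e) (r j) t ⊎ In (d j) (d j + e) t)
      outside? t = in? (r j ∸ e) (r j) t ⊎-dec in? (d j) (d j + e) t
      split : Near t j → Alive t j ⊎ (In (r j ∸ e) (r j) t ⊎ In (d j) (d j + e) t)
      split (r≤ , <d+e) with r j ≤? t | t <? d j
      ... | no r≰t  | _       = inj₂ (inj₁ (m≤n+o⇒m∸n≤o (r j) e (≤-trans r≤ (≤-reflexive (+-comm t e))) , ≰⇒> r≰t))
      ... | yes _   | no t≮d  = inj₂ (inj₂ (≮⇒≥ t≮d , <d+e))
      ... | yes r≤t | yes t<d = inj₁ (r≤t , t<d)

  -- Double counting of pairs of a crowded time of the window and a job loose at it: there are at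
  -- least `31 * m` per time. Processing explains at most `m` per time. The rest is idle time, at
  -- most `3 * len j / K` per job, and the lifespans concerned add up to at most `10 * m * L`,
  -- because half of each is processed within the same `5 * L` units. This leaves `30 * m` pairs per
  -- time against `30 * m * L / K` in total.
  crowded-rare : ∀ L a → K * ∑< L (λ τ → 𝟙 (crowded? L (a + τ))) ≤ L
  crowded-rare L a = ≤-trans (*-monoʳ-≤ K count≤) $ *-cancelˡ-≤ (30 * (m * N)) {{m*n≢0 30 (m * N) {{_}} {{m*n≢0 m N}}}} $
    ≤-by 0 total (arith m N (K * ∣Z∣) L)
    where
    open ≤-Reasoning
    H = horizon + (a + 3 * L)
    d≤H : ∀ j → d j ≤ H
    d≤H j = ≤-trans (d≤horizon j) (m≤m+n horizon _)
    arith : ∀ m N Z L → 30 * (m * N) * Z + (m * N * Z + 6 * (m * N * (5 * L))) + 0 ≡ 30 * (m * N) * L + 31 * m * N * Z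
    arith = solve-∀

    Z? : ∀ t → Dec (In a (a + L) t × 31 * m ≤ card (loose? L t))
    Z? t = in? a (a + L) t ×-dec crowded? L t
    ∣Z∣ = ∑< H (λ t → 𝟙 (Z? t))

    -- A job loose at a time of the window has margin and lifespan at most `L`, so its whole
    -- lifespan lies in this larger window.
    W? : ∀ t → Dec (In (a ∸ 2 * L) (a + 3 * L) t)
    W? = in? (a ∸ 2 * L) (a + 3 * L)

    -- What looseness at some time of the window implies about `j` alone; being independent of the
    -- time, it factors out of the sum over time.
    close? : ∀ j → Dec (len j ≤ L × a ≤ d j + L × r j ≤ a + 2 * L)
    close? j = (len j ≤? L) ×-dec (a ≤? d j + L) ×-dec (r j ≤? a + 2 * L)

    count≤ : ∑< L (λ τ → 𝟙 (crowded? L (a + τ))) ≤ ∣Z∣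
    count≤ = begin
      ∑< L (λ τ → 𝟙 (crowded? L (a + τ)))
        ≤⟨ window≤∑< a L _ (≤-trans (+-monoʳ-≤ a (m≤m+n L _)) (m≤n+m _ horizon)) ⟩
      ∑< H (λ t → 𝟙 (in? a (a + L) t) * 𝟙 (crowded? L t))
        ≤⟨ ∑<-mono H (λ t _ → 𝟙-*-≤ (in? a (a + L) t) λ t∈ → 𝟙-mono (crowded? L t) (Z? t) (t∈ ,_)) ⟩
      ∣Z∣ ∎

    visits : Fin n → ℕ
    visits j = 𝟙 (close? j) * ∑< H (λ t → 𝟙 (Z? t) * 𝟙 (near? t j))

    31m∣Z∣≤ : 31 * m * ∣Z∣ ≤ sum visits
    31m∣Z∣≤ = begin
      31 * m * ∣Z∣
        ≡⟨ *-distribˡ-∑< H (31 * m) _ ⟩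
      ∑< H (λ t → 31 * m * 𝟙 (Z? t))
        ≤⟨ ∑<-mono H (λ t _ → ≤-trans (≤-reflexive (*-comm (31 * m) _)) (𝟙-*-≤ (Z? t) (λ z → ≤-trans (proj₂ z) (sum-mono λ j → pointwise t z j)))) ⟩
      ∑< H (λ t → sum (λ j → 𝟙 (close? j) * (𝟙 (Z? t) * 𝟙 (near? t j))))
        ≡⟨ ∑<-sum-comm H (λ j t → 𝟙 (close? j) * (𝟙 (Z? t) * 𝟙 (near? t j))) ⟩
      sum (λ j → ∑< H (λ t → 𝟙 (close? j) * (𝟙 (Z? t) * 𝟙 (near? t j))))
        ≡⟨ sum-cong-≗ (λ j → sym (*-distribˡ-∑< H (𝟙 (close? j)) _)) ⟩
      sum visits ∎
      where
      pointwise : ∀ t → In a (a + L) t × 31 * m ≤ card (loose? L t) → ∀ j →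
                  𝟙 (loose? L t j) ≤ 𝟙 (close? j) * (𝟙 (Z? t) * 𝟙 (near? t j))
      pointwise t z@((a≤t , t<a+L) , _) j = ≤-trans (≤-reflexive (sym (*-identityʳ (𝟙 (loose? L t j))))) (𝟙-*-≤ (loose? L t j) λ where
        (len≤L , near@(r≤ , <d+e)) →
          let e≤L = ≤-trans (margin≤len j) len≤L in
          *-mono-≤ (𝟙-yes (close? j) ( len≤L
                                     , ≤-trans a≤t (≤-trans (<⇒≤ <d+e) (+-monoʳ-≤ (d j) e≤L))
                                     , ≤-trans r≤ (≤-trans (+-mono-≤ (<⇒≤ t<a+L) e≤L) (≤-reflexive (arith′ a L)))))
                   (*-mono-≤ (𝟙-yes (Z? t) z) (𝟙-yes (near? t j) near)))
        where
        arith′ : ∀ a L → a + L + L ≡ a + 2 * L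
        arith′ = solve-∀

    visits≤ : ∀ j → K * N * visits j ≤ K * processed Z? H j + 6 * processed W? H j
    visits≤ j = begin
      K * N * (𝟙 (close? j) * y)          ≡⟨ arith₁ (K * N) (𝟙 (close? j)) y ⟩
      𝟙 (close? j) * (K * N * y)          ≤⟨ 𝟙-*-≤ (close? j) bound ⟩
      K * processed Z? H j + 6 * processed W? H j ∎
      where
      y = ∑< H (λ t → 𝟙 (Z? t) * 𝟙 (near? t j))
      arith₁ : ∀ x y z → x * (y * z) ≡ y * (x * z)
      arith₁ = solve-∀
      arith₂ : ∀ K P N s → K * (P + N * s) ≡ K * P + N * (K * s)
      arith₂ = solve-∀
      arith₃ : ∀ N l → N * (3 * l) ≡ 3 * (N * l)
      arith₃ = solve-∀
      arith₄ : ∀ P → 3 * (2 * P) ≡ 6 * P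
      arith₄ = solve-∀
      arith₅ : ∀ a L → a + 2 * L + L ≡ a + 3 * L
      arith₅ = solve-∀
      arith₆ : ∀ r L → r + L + L ≡ 2 * L + r
      arith₆ = solve-∀
      bound : len j ≤ L × a ≤ d j + L × r j ≤ a + 2 * L → K * N * y ≤ K * processed Z? H j + 6 * processed W? H j
      bound (len≤L , a≤d+L , r≤a+2L) = begin
        K * N * y
          ≡⟨ *-assoc K N y ⟩
        K * (N * y)
          ≤⟨ *-monoʳ-≤ K (near-processed Z? j (d≤H j)) ⟩
        K * (processed Z? H j + N * (slack j + 2 * margin j))
          ≡⟨ arith₂ K (processed Z? H j) N _ ⟩
        K * processed Z? H j + N * (K * (slack j + 2 * margin j))
          ≤⟨ +-monoʳ-≤ (K * processed Z? H j) (*-monoʳ-≤ N (K*[slack+2*margin]≤3*len j)) ⟩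
        K * processed Z? H j + N * (3 * len j)
          ≡⟨ cong (K * processed Z? H j +_) (arith₃ N (len j)) ⟩
        K * processed Z? H j + 3 * (N * len j)
          ≤⟨ +-monoʳ-≤ (K * processed Z? H j) (*-monoʳ-≤ 3 (processed-lifespan-≥ W? j (d≤H j) λ t (r≤t , t<d) →
               m≤n+o⇒m∸n≤o a (2 * L) (≤-trans a≤2L+r (+-monoʳ-≤ (2 * L) r≤t)) , <-≤-trans t<d d≤a+3L)) ⟩
        K * processed Z? H j + 3 * (2 * processed W? H j)
          ≡⟨ cong (K * processed Z? H j +_) (arith₄ (processed W? H j)) ⟩
        K * processed Z? H j + 6 * processed W? H j ∎
        where
        d≤r+L : d j ≤ r j + L
        d≤r+L = ≤-trans (≤-reflexive (sym (r+len j))) (+-monoʳ-≤ (r j) len≤L)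
        d≤a+3L : d j ≤ a + 3 * L
        d≤a+3L = ≤-trans d≤r+L (≤-trans (+-monoˡ-≤ L r≤a+2L) (≤-reflexive (arith₅ a L)))
        a≤2L+r : a ≤ 2 * L + r j
        a≤2L+r = ≤-trans a≤d+L (≤-trans (+-monoˡ-≤ L d≤r+L) (≤-reflexive (arith₆ (r j) L)))

    ∣W∣≤ : ∑< H (λ t → 𝟙 (W? t)) ≤ 5 * L
    ∣W∣≤ = ≤-trans (∑<-in-≤ H (a ∸ 2 * L) (a + 3 * L)) (m≤n+o⇒m∸n≤o (a + 3 * L) (a ∸ 2 * L)
      (≤-trans (+-monoˡ-≤ (3 * L) (m≤n+m∸n a (2 * L))) (≤-reflexive (arith′ L (a ∸ 2 * L)))))
      where
      arith′ : ∀ L x → 2 * L + x + 3 * L ≡ x + 5 * L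
      arith′ = solve-∀

    total : 31 * m * N * (K * ∣Z∣) ≤ m * N * (K * ∣Z∣) + 6 * (m * N * (5 * L))
    total = begin
      31 * m * N * (K * ∣Z∣)
        ≡⟨ arith₁ m N K ∣Z∣ ⟩
      K * N * (31 * m * ∣Z∣)
        ≤⟨ *-monoʳ-≤ (K * N) 31m∣Z∣≤ ⟩
      K * N * sum visits
        ≡⟨ *-distribˡ-sum (K * N) visits ⟩
      sum (λ j → K * N * visits j)
        ≤⟨ sum-mono visits≤ ⟩
      sum (λ j → K * processed Z? H j + 6 * processed W? H j)
        ≡⟨ ∑-distrib-+ (λ j → K * processed Z? H j) (λ j → 6 * processed W? H j) ⟩
      sum (λ j → K * processed Z? H j) + sum (λ j → 6 * processed W? H j)
        ≡⟨ cong₂ _+_ (*-distribˡ-sum K (processed Z? H)) (*-distribˡ-sum 6 (processed W? H)) ⟨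
      K * sum (processed Z? H) + 6 * sum (processed W? H)
        ≤⟨ +-mono-≤ (*-monoʳ-≤ K (∑-processed-≤ Z? H))
                    (*-monoʳ-≤ 6 (≤-trans (∑-processed-≤ W? H) (*-monoʳ-≤ (m * N) ∣W∣≤))) ⟩
      K * (m * N * ∣Z∣) + 6 * (m * N * (5 * L))
        ≡⟨ cong (_+ 6 * (m * N * (5 * L))) (arith₂ K (m * N) ∣Z∣) ⟩
      m * N * (K * ∣Z∣) + 6 * (m * N * (5 * L)) ∎
      where
      arith₁ : ∀ m N K Z → 31 * m * N * (K * Z) ≡ K * N * (31 * m * Z)
      arith₁ = solve-∀
      arith₂ : ∀ K x Z → K * (x * Z) ≡ x * (K * Z)
      arith₂ = solve-∀

  -- Overloaded times, by bisection

  Short : ℕ → ℕ → Fin n → Set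
  Short L t j = len j ≤ L × Alive t j

  short? : ∀ L t j → Dec (Short L t j)
  short? L t j = (len j ≤? L) ×-dec alive? t j

  overloaded? : ∀ k L t → Dec (k * (63 * m) ≤ card (short? L t))
  overloaded? k L t = k * (63 * m) ≤? card (short? L t)

  -- s is the length of the current piece [a , a + s) and L that of the initial window.
  Wide : ℕ → ℕ → ℕ → Fin n → Set
  Wide L a s j = len j ≤ L × K * s ≤ len j × r j < a + s × a < d j

  wide? : ∀ L a s j → Dec (Wide L a s j)
  wide? L a s j = (len j ≤? L) ×-dec (K * s ≤? len j) ×-dec (r j <? a + s) ×-dec (a <? d j)

  -- A job meeting the piece anywhere is within distance `s` of all its times, and `s ≤ margin j`
  -- because `s` is an integer with `K * s ≤ len j`.
  wide⇒loose : ∀ {L a s t j} → In a (a + s) t → Wide L a s j → Loose L t j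
  wide⇒loose {L} {a} {s} {t} {j} (a≤t , t<a+s) (len≤L , Ks≤len , r<a+s , a<d) =
    len≤L , ≤-trans (<⇒≤ r<a+s) (+-mono-≤ a≤t s≤margin) , <-≤-trans t<a+s (+-mono-≤ (<⇒≤ a<d) s≤margin)
    where
    s≤margin : s ≤ margin j
    s≤margin = begin
      s            ≡⟨ m*n/n≡m s K ⟨
      s * K / K    ≤⟨ /-monoˡ-≤ K (≤-trans (≤-reflexive (*-comm s K)) Ks≤len) ⟩
      margin j     ∎
      where open ≤-Reasoning

  -- The threshold `K * (2 * s)` is that of `Wide` for the parent piece of length `2 * s`, which was
  -- not stopped.
  Long : ℕ → ℕ → ℕ → Fin n → Set
  Long L s t j = len j ≤ L × K * (2 * s) ≤ len j × Alive t j

  long? : ∀ L s t j → Dec (Long L s t j)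
  long? L s t j = (len j ≤? L) ×-dec (K * (2 * s) ≤? len j) ×-dec alive? t j

  -- Laxities are positive integers. This is what ends the bisection at pieces of length 1.
  K≤len : ∀ j → K ≤ len j
  K≤len j = ≤-trans (m≤m*n K (slack j) {{slack≢0 j}}) (K*slack≤len j)

  -- Induction on `l`, bisecting the piece `[a , a + 2 ^ l)` while `L` stays fixed. The hypothesis
  -- records that the parent piece was not stopped.
  overloaded≤crowded : ∀ k L l a →
    (∀ t → In a (a + 2 ^ l) t → card (long? L (2 ^ l) t) < 31 * m) →
    K ^ k * ∑< (2 ^ l) (λ τ → 𝟙 (overloaded? (suc k) L (a + τ))) ≤ ∑< (2 ^ l) (λ τ → 𝟙 (crowded? L (a + τ)))

  -- Mutual induction with `overloaded≤crowded`: the step from `k` to `suc k` gains one factor `K`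
  -- from `crowded-rare`, and the factor `K ^ k` comes from this bound on the stopped pieces.
  overloaded-rare : ∀ k l a → K ^ k * ∑< (2 ^ l) (λ τ → 𝟙 (overloaded? k (2 ^ l) (a + τ))) ≤ 2 ^ l
  overloaded-rare zero l a = begin
    1 * ∑< (2 ^ l) (λ τ → 𝟙 (overloaded? 0 (2 ^ l) (a + τ)))  ≡⟨ *-identityˡ _ ⟩
    ∑< (2 ^ l) (λ τ → 𝟙 (overloaded? 0 (2 ^ l) (a + τ)))
      ≤⟨ ∑<-mono (2 ^ l) (λ τ _ → 𝟙≤1 (overloaded? 0 (2 ^ l) (a + τ))) ⟩
    ∑< (2 ^ l) (λ _ → 1)                                      ≡⟨ ∑<-const (2 ^ l) 1 ⟩
    2 ^ l * 1                                                 ≡⟨ *-identityʳ (2 ^ l) ⟩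
    2 ^ l                                                     ∎
    where open ≤-Reasoning
  overloaded-rare (suc k) l a = begin
    K ^ suc k * E             ≡⟨ *-assoc K (K ^ k) E ⟩
    K * (K ^ k * E)           ≤⟨ *-monoʳ-≤ K (overloaded≤crowded k (2 ^ l) l a no-wide) ⟩
    K * ∑< (2 ^ l) (λ τ → 𝟙 (crowded? (2 ^ l) (a + τ)))  ≤⟨ crowded-rare (2 ^ l) a ⟩
    2 ^ l                     ∎
    where
    open ≤-Reasoning
    E = ∑< (2 ^ l) (λ τ → 𝟙 (overloaded? (suc k) (2 ^ l) (a + τ)))
    s = 2 ^ l
    -- The initial piece has length `L` itself, so jobs of lifespan at most `L` are too short to be
    -- long.
    no-wide : ∀ t → In a (a + s) t → card (long? s s t) < 31 * m
    no-wide t _ = ≤-trans (≤-reflexive (cong suc (card-zero (long? s s t) λ j (len≤s , 2Ks≤len , _) →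
      <⇒≱ (s<K*2s) (≤-trans 2Ks≤len len≤s)))) (m*n>0 31 m)
      where
      m*n>0 : ∀ a b {{_ : NonZero a}} {{_ : NonZero b}} → 1 ≤ a * b
      m*n>0 a b = >-nonZero⁻¹ (a * b) {{m*n≢0 a b}}
      s<K*2s : s < K * (2 * s)
      s<K*2s = begin-strict
        s            <⟨ m<m*n s 2 {{m^n≢0 2 l}} (s≤s (s≤s z≤n)) ⟩
        s * 2        ≡⟨ *-comm s 2 ⟩
        2 * s        ≤⟨ m≤n*m (2 * s) K ⟩
        K * (2 * s)  ∎

  overloaded≤crowded k L l a few with 31 * m ≤? card (wide? L a (2 ^ l))
  -- The piece is stopped. All its times are crowded, so the right side is at least `s`; the left
  -- side is at most `s` by the bound for `k` at scale `s`.
  ... | yes many = begin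
    K ^ k * ∑< s (λ τ → 𝟙 (overloaded? (suc k) L (a + τ)))
      ≤⟨ *-monoʳ-≤ (K ^ k) (∑<-mono s λ τ τ<s → 𝟙-mono (overloaded? (suc k) L (a + τ)) (overloaded? k s (a + τ)) (drop (a + τ) (inside τ<s))) ⟩
    K ^ k * ∑< s (λ τ → 𝟙 (overloaded? k s (a + τ)))
      ≤⟨ overloaded-rare k l a ⟩
    s
      ≡⟨ *-identityʳ s ⟨
    s * 1
      ≡⟨ ∑<-const s 1 ⟨
    ∑< s (λ _ → 1)
      ≤⟨ ∑<-mono s (λ τ τ<s → 𝟙-yes (crowded? L (a + τ)) (≤-trans many
           (card-mono (wide? L a s) (loose? L (a + τ)) λ j → wide⇒loose {j = j} (inside τ<s)))) ⟩
    ∑< s (λ τ → 𝟙 (crowded? L (a + τ))) ∎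
    where
    open ≤-Reasoning
    s = 2 ^ l
    inside : ∀ {τ} → τ < s → In a (a + s) (a + τ)
    inside τ<s = m≤m+n a _ , +-monoʳ-< a τ<s
    arith : ∀ x m → x + (31 * m + 32 * m) ≡ 63 * m + x
    arith = solve-∀
    drop : ∀ t → In a (a + s) t → suc k * (63 * m) ≤ card (short? L t) → k * (63 * m) ≤ card (short? s t)
    -- Here `63 = 31 + 32`: passing from scale `L` to scale `s` drops fewer than `31 * m` long and
    -- at most `32 * m` intermediate jobs.
    drop t t∈ over = +-cancelʳ-≤ (31 * m + 32 * m) _ _ $ begin
      k * (63 * m) + (31 * m + 32 * m)                              ≡⟨ arith (k * (63 * m)) m ⟩
      suc k * (63 * m)                                              ≤⟨ over ⟩
      card (short? L t)
        ≤⟨ card-⊎ (short? L t) (short? s t) rest? split ⟩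
      card (short? s t) + card rest?
        ≤⟨ +-monoʳ-≤ (card (short? s t)) (card-⊎ rest? (long? L s t) (mid? s t) λ _ x → x) ⟩
      card (short? s t) + (card (long? L s t) + card (mid? s t))
        ≤⟨ +-monoʳ-≤ (card (short? s t)) (+-mono-≤ (<⇒≤ (few t t∈)) (card-mid s {{m^n≢0 2 l}} t)) ⟩
      card (short? s t) + (31 * m + 32 * m)                         ∎
      where
      rest? : ∀ j → Dec (Long L s t j ⊎ Mid s t j)
      rest? j = long? L s t j ⊎-dec mid? s t j
      split : ∀ j → Short L t j → Short s t j ⊎ (Long L s t j ⊎ Mid s t j)
      split j (len≤L , alive) with len j ≤? s | K * (2 * s) ≤? len j
      ... | yes len≤s | _       = inj₁ (len≤s , alive)
      ... | no _      | yes K≤  = inj₂ (inj₁ (len≤L , K≤ , alive))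
      ... | no len≰s  | no K≰   = inj₂ (inj₂ (alive , ≰⇒> len≰s , ≰⇒> K≰))
  -- On a single unit of time all short jobs are wide, by `K≤len`. An overload would have stopped
  -- the piece, so the left side vanishes.
  overloaded≤crowded k L zero a few | no ¬many = begin
    K ^ k * 𝟙 (overloaded? (suc k) L (a + 0))
      ≡⟨ cong (K ^ k *_) (𝟙-no (overloaded? (suc k) L (a + 0)) λ over → ¬many (≤-trans 31m≤ (≤-trans over all-wide))) ⟩
    K ^ k * 0                                  ≡⟨ *-zeroʳ (K ^ k) ⟩
    0                                          ≤⟨ z≤n ⟩
    𝟙 (crowded? L (a + 0))                     ∎
    where
    open ≤-Reasoning
    31m≤ : 31 * m ≤ suc k * (63 * m)
    31m≤ = ≤-trans (*-monoˡ-≤ m (m≤m+n 31 32)) (m≤m+n (63 * m) _)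
    all-wide : card (short? L (a + 0)) ≤ card (wide? L a 1)
    all-wide = card-mono (short? L (a + 0)) (wide? L a 1) λ j (len≤L , r≤a+0 , a+0<d) →
      len≤L , ≤-trans (≤-reflexive (*-identityʳ K)) (K≤len j) ,
      ≤-<-trans r≤a+0 (+-monoʳ-< a (s≤s z≤n)) , subst (_< d j) (+-identityʳ a) a+0<d
  -- A job long for a half is wide for the whole piece, so both halves inherit the hypothesis from
  -- the failure to stop.
  overloaded≤crowded k L (suc l) a few | no ¬many = begin
    K ^ k * ∑< (2 ^ suc l) E                                                   ≡⟨ cong (K ^ k *_) (halves E) ⟩
    K ^ k * (∑< s E + ∑< s (λ τ → E (s + τ)))
      ≡⟨ cong (λ x → K ^ k * (∑< s E + x)) (∑<-cong s λ τ _ → cong (λ t → 𝟙 (overloaded? (suc k) L t)) (+-assoc a s τ)) ⟨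
    K ^ k * (∑< s E + ∑< s (λ τ → 𝟙 (overloaded? (suc k) L (a + s + τ))))      ≡⟨ *-distribˡ-+ (K ^ k) _ _ ⟩
    K ^ k * ∑< s E + K ^ k * ∑< s (λ τ → 𝟙 (overloaded? (suc k) L (a + s + τ)))
      ≤⟨ +-mono-≤ (overloaded≤crowded k L l a λ t (a≤t , t<a+s) → few′ t (a≤t , <-≤-trans t<a+s (+-monoʳ-≤ a (m≤m+n s _))))
                                                                                            (overloaded≤crowded k L l (a + s) λ t (a+s≤t , t<) → few′ t (m+n≤o⇒m≤o a a+s≤t , <-≤-trans t< (≤-reflexive (arith a s)))) ⟩
    ∑< s F + ∑< s (λ τ → 𝟙 (crowded? L (a + s + τ)))
      ≡⟨ cong (∑< s F +_) (∑<-cong s λ τ _ → cong (λ t → 𝟙 (crowded? L t)) (+-assoc a s τ)) ⟩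
    ∑< s F + ∑< s (λ τ → F (s + τ))                                            ≡⟨ halves F ⟨
    ∑< (2 ^ suc l) F                                                           ∎
    where
    open ≤-Reasoning
    s = 2 ^ l
    arith : ∀ a s → a + s + s ≡ a + 2 * s
    arith = solve-∀
    E F : ℕ → ℕ
    E τ = 𝟙 (overloaded? (suc k) L (a + τ))
    F τ = 𝟙 (crowded? L (a + τ))
    halves : ∀ f → ∑< (2 ^ suc l) f ≡ ∑< s f + ∑< s (λ τ → f (s + τ))
    halves f = trans (cong (λ x → ∑< (s + x) f) (+-identityʳ s)) (∑<-split s s f)
    few′ : ∀ t → In a (a + 2 * s) t → card (long? L s t) < 31 * m
    few′ t (a≤t , t<) = ≤-<-trans (card-mono (long? L s t) (wide? L a (2 * s)) λ j (len≤L , K≤ , r≤t , t<d) →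
      len≤L , K≤ , ≤-<-trans r≤t t< , ≤-<-trans a≤t t<d) (≰⇒> ¬many)

-- Feasibility of Shortest Job First

module _ {n M : ℕ} (S : Schedule n M) where

  slotsBefore-∑< : ∀ k j → slotsBefore S k j ≡ ∑< k (λ q → 𝟙 (runs? S q j))
  slotsBefore-∑< zero    j = refl
  slotsBefore-∑< (suc k) j with runs? S k j
  ... | yes _ = trans (cong suc (slotsBefore-∑< k j)) (+-comm 1 _)
  ... | no _  = trans (slotsBefore-∑< k j) (sym (+-identityʳ _))

  slotsBefore-mono : ∀ {k k′} → k ≤ k′ → ∀ j → slotsBefore S k j ≤ slotsBefore S k′ j
  slotsBefore-mono {k} {k′} k≤k′ j rewrite slotsBefore-∑< k j | slotsBefore-∑< k′ j = ∑<-monoˡ k≤k′ _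

  unitWork : Fin n → ℕ → ℕ
  unitWork j t = ∑< (resolution S) (λ i → 𝟙 (runs? S (t * resolution S + i) j))

  slotsBefore-unitWork : ∀ t j → slotsBefore S (t * resolution S) j ≡ ∑< t (unitWork j)
  slotsBefore-unitWork t j = trans (slotsBefore-∑< (t * resolution S) j) (∑<-blocks t (resolution S) _)

  assigned? : ∀ k i j → Dec (assign S k i ≡ just j)
  assigned? k i j = ≡-dec _≟ᶠ_ (assign S k i) (just j)

  card-runs : ∀ k → card (runs? S k) ≤ M
  card-runs k = begin
    card (runs? S k)                               ≤⟨ sum-mono runs≤ ⟩
    sum (λ j → sum (λ i → 𝟙 (assigned? k i j)))    ≡⟨ ∑-comm (λ j i → 𝟙 (assigned? k i j)) ⟩
    sum (λ i → card (assigned? k i))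
      ≤⟨ sum-≤* (λ i → card≤1 (assigned? k i) λ p q → just-injective (trans (sym p) q)) ⟩
    M * 1                                          ≡⟨ *-identityʳ M ⟩
    M                                              ∎
    where
    open ≤-Reasoning
    runs≤ : ∀ j → 𝟙 (runs? S k j) ≤ sum (λ i → 𝟙 (assigned? k i j))
    runs≤ j with runs? S k j
    ... | no _        = z≤n
    ... | yes (i , p) = ≤-trans (𝟙-yes (assigned? k i j) p) (term≤sum (λ i → 𝟙 (assigned? k i j)) i)

  -- Double counting of machines and the jobs on them; `oneMachineAtATime` ensures that no job
  -- accounts for two machines.
  machines≤card : ∀ {P : Fin n → Set} (P? : ∀ j → Dec (P j)) k →
    (∀ i → ∃[ j ] assign S k i ≡ just j × P j) → M ≤ card P?
  machines≤card {P} P? k busy = begin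
    M                                        ≡⟨ sum-1 M ⟨
    sum {M} (λ _ → 1)
      ≤⟨ sum-mono (λ i → ≤-trans (𝟙-yes (on? i (proj₁ (busy i))) (proj₂ (busy i))) (term≤sum (λ j → 𝟙 (on? i j)) _)) ⟩
    sum (λ i → sum (λ j → 𝟙 (on? i j)))      ≡⟨ ∑-comm (λ i j → 𝟙 (on? i j)) ⟩
    sum (λ j → card (λ i → on? i j))         ≤⟨ sum-mono at-most-one ⟩
    card P?                                  ∎
    where
    open ≤-Reasoning
    on? : ∀ i j → Dec (assign S k i ≡ just j × P j)
    on? i j = assigned? k i j ×-dec P? j
    at-most-one : ∀ j → card (λ i → on? i j) ≤ 𝟙 (P? j)
    at-most-one j = [ (λ p → ≤-trans (card≤1 (λ i → on? i j) λ a b → oneMachineAtATime S k (proj₁ a) (proj₁ b)) (𝟙-yes (P? j) p))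
                    , (λ ¬p → ≤-trans (≤-reflexive (card-zero (λ i → on? i j) λ i → ¬p ∘ proj₂)) z≤n) ]′ (toSum (P? j))

-- Bisection needs windows whose length is a power of two; rounding up costs a factor of at most 2.
2^-between : ∀ x {{_ : NonZero x}} → ∃[ l ] x ≤ 2 ^ l × 2 ^ l ≤ 2 * x
2^-between (suc zero)      = 0 , ≤-refl , s≤s z≤n
2^-between (suc x@(suc _)) with 2^-between x
... | l , x≤2^l , 2^l≤2x with suc x ≤? 2 ^ l
...   | yes 1+x≤2^l = l , 1+x≤2^l , ≤-trans 2^l≤2x (*-monoʳ-≤ 2 (n≤1+n x))
...   | no 1+x≰2^l  = suc l
  , ≤-trans (+-mono-≤ (>-nonZero⁻¹ (2 ^ l) {{m^n≢0 2 l}}) x≤2^l) (≤-reflexive (cong (2 ^ l +_) (sym (+-identityʳ (2 ^ l)))))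
  , *-monoʳ-≤ 2 (<⇒≤ (≰⇒> 1+x≰2^l))

module _ {n} (J : Instance n) (K : ℕ) {{_ : NonZero K}} (2≤K : 2 ≤ K)
  (slack : Fin n → ℕ)
  (size+slack : ∀ j → size (J j) + slack j ≡ lifespanLength (J j))
  (K*slack≤len : ∀ j → K * slack j ≤ lifespanLength (J j))
  (slack≢0 : ∀ j → NonZero (slack j))
  {m} {{_ : NonZero m}} (S₀ : Schedule n m) (feasible : Feasible J S₀)
  where

  private
    N = resolution S₀

    -- `Feasible` does not forbid work on a job after its deadline; the indicator cuts such work
    -- off.
    w : Fin n → ℕ → ℕ
    w j t = 𝟙 (in? (release (J j)) (deadline (J j)) t) * unitWork S₀ j t

    unitWork≤N : ∀ j t → unitWork S₀ j t ≤ N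
    unitWork≤N j t = begin
      unitWork S₀ j t     ≤⟨ ∑<-mono N (λ i _ → 𝟙≤1 (runs? S₀ (t * N + i) j)) ⟩
      ∑< N (λ _ → 1)      ≡⟨ ∑<-const N 1 ⟩
      N * 1               ≡⟨ *-identityʳ N ⟩
      N                   ∎
      where open ≤-Reasoning

    w≤alive : ∀ j t → w j t ≤ N * 𝟙 (in? (release (J j)) (deadline (J j)) t)
    w≤alive j t = ≤-trans (*-monoʳ-≤ (𝟙 alive?) (unitWork≤N j t)) (≤-reflexive (*-comm (𝟙 alive?) N))
      where alive? = in? (release (J j)) (deadline (J j)) t

    w-capacity : ∀ t → sum (λ j → w j t) ≤ m * N
    w-capacity t = begin
      sum (λ j → w j t)
        ≤⟨ sum-mono (λ j → 𝟙-*-≤ (in? (release (J j)) (deadline (J j)) t) λ _ → ≤-refl) ⟩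
      sum (λ j → unitWork S₀ j t)                           ≡⟨ ∑<-sum-comm N (λ j i → 𝟙 (runs? S₀ (t * N + i) j)) ⟨
      ∑< N (λ i → card (runs? S₀ (t * N + i)))              ≤⟨ ∑<-mono N (λ i _ → card-runs S₀ (t * N + i)) ⟩
      ∑< N (λ _ → m)                                        ≡⟨ ∑<-const N m ⟩
      N * m                                                 ≡⟨ *-comm N m ⟩
      m * N                                                 ∎
      where open ≤-Reasoning

    -- Release times are integers, so a job released by some slot of unit `t` is released by the
    -- start of that unit.
    released-in-unit : ∀ {x t i} N {{_ : NonZero N}} → i < N → x * N ≤ t * N + i → x ≤ t
    released-in-unit {x} {t} {i} N i<N xN≤ = ≮⇒≥ λ t<x → <⇒≱ (begin-strict
      t * N + i      <⟨ +-monoʳ-< (t * N) i<N ⟩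
      t * N + N      ≡⟨ +-comm (t * N) N ⟩
      suc t * N      ≤⟨ *-monoˡ-≤ N t<x ⟩
      x * N          ∎) xN≤
      where open ≤-Reasoning

    w-total : ∀ j → size (J j) * N ≤ ∑< (deadline (J j)) (w j)
    w-total j = begin
      size (J j) * N                             ≤⟨ proj₂ (feasible j) ⟩
      slotsBefore S₀ (deadline (J j) * N) j      ≡⟨ slotsBefore-unitWork S₀ (deadline (J j)) j ⟩
      ∑< (deadline (J j)) (unitWork S₀ j)        ≤⟨ ∑<-mono (deadline (J j)) within ⟩
      ∑< (deadline (J j)) (w j)                  ∎
      where
      open ≤-Reasoning
      within : ∀ t → t < deadline (J j) → unitWork S₀ j t ≤ w j t
      within t t<d with release (J j) ≤? t
      ... | yes r≤t = ≤-trans (≤-reflexive (sym (*-identityˡ (unitWork S₀ j t))))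
                              (*-monoˡ-≤ (unitWork S₀ j t) (𝟙-yes (in? _ _ t) (r≤t , t<d)))
      ... | no r≰t  = begin
        unitWork S₀ j t   ≤⟨ ∑<-mono N (λ i i<N → ≤-reflexive (𝟙-no (runs? S₀ (t * N + i) j) λ runs →
                               r≰t (released-in-unit N i<N (proj₁ (feasible j) _ runs)))) ⟩
        ∑< N (λ _ → 0)    ≡⟨ ∑<-const N 0 ⟩
        N * 0             ≡⟨ *-zeroʳ N ⟩
        0                 ≤⟨ z≤n ⟩
        w j t             ∎

    open Core J m N K 2≤K slack size+slack K*slack≤len slack≢0 w w≤alive w-capacity w-total

    -- Makes the order by size, on which SJF acts, an order by lifespan up to a factor 2.
    len≤2*size : ∀ j → len j ≤ 2 * p j
    len≤2*size j = ≤-trans (≤-reflexive (sym (size+slack j)))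
      (≤-by 0 (≤-trans (2*slack≤len j) (≤-reflexive (sym (size+slack j)))) (arith (p j) (slack j)))
      where
      arith : ∀ p s → p + s + (p + s) + 0 ≡ 2 * p + 2 * s
      arith = solve-∀

  module _ (k Λ : ℕ) (4*Λ≤K^k : 4 * Λ ≤ K ^ k) (len≤Λ*slack : ∀ j → lifespanLength (J j) ≤ Λ * slack j)
    (S : Schedule n (63 * k * m)) (sjf : SJF J S) where

    private
      N′ = resolution S

      starts-after-release : ∀ {q j} → Runs S q j → Released S J q j
      starts-after-release {q} {j} runs = proj₁ (proj₁ (sjf q) j runs)

      -- The jobs on the machines have lifespan at most `2 * len j` since their sizes are at most
      -- `p j`. They are alive at `t`: one with deadline at most `t < d j` would be completed by
      -- `earlier`, and SJF would not run it.
      idle⇒overloaded : ∀ {l j t i} → 2 * len j ≤ 2 ^ l → (∀ j′ → deadline (J j′) < deadline (J j) → Completed S J (d j′ * N′) j′) →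
        Alive t j → i < N′ → ¬ Completed S J (d j * N′) j → ¬ Runs S (t * N′ + i) j →
        k * (63 * m) ≤ card (short? (2 ^ l) t)
      idle⇒overloaded {l} {j} {t} {i} 2len≤2^l earlier (r≤t , t<d) i<N′ incomplete idle =
        ≤-trans (≤-reflexive (arith k m)) (machines≤card S (short? (2 ^ l) t) q busy)
        where
        open ≤-Reasoning
        arith : ∀ k m → k * (63 * m) ≡ 63 * k * m
        arith = solve-∀
        q = t * N′ + i
        q≤ : ∀ {x} → t < x → q ≤ x * N′
        q≤ {x} t<x = begin
          t * N′ + i   ≤⟨ +-monoʳ-≤ (t * N′) (<⇒≤ i<N′) ⟩
          t * N′ + N′  ≡⟨ +-comm (t * N′) N′ ⟩
          suc t * N′   ≤⟨ *-monoˡ-≤ N′ t<x ⟩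
          x * N′       ∎
        available : Released S J q j × ¬ Completed S J q j
        available = ≤-trans (*-monoˡ-≤ N′ r≤t) (m≤m+n _ i)
                  , λ completed → incomplete (≤-trans completed (slotsBefore-mono S (q≤ t<d) j))
        busy : ∀ i′ → ∃[ j′ ] assign S q i′ ≡ just j′ × Short (2 ^ l) t j′
        busy i′ with proj₂ (sjf q) j available idle i′
        ... | j′ , eq , p′≤p with proj₁ (sjf q) j′ (i′ , eq)
        ...   | released , ¬completed = j′ , eq , len′≤ , released-in-unit N′ i<N′ released , ≰⇒> d′≰t
          where
          len′≤ : len j′ ≤ 2 ^ l
          len′≤ = begin
            len j′     ≤⟨ len≤2*size j′ ⟩
            2 * p j′   ≤⟨ *-monoʳ-≤ 2 p′≤p ⟩
            2 * p j    ≤⟨ *-monoʳ-≤ 2 (m+n≤o⇒m≤o (p j) (≤-reflexive (size+slack j))) ⟩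
            2 * len j  ≤⟨ 2len≤2^l ⟩
            2 ^ l      ∎
          d′≰t : ¬ d j′ ≤ t
          d′≰t d′≤t = ¬completed (≤-trans (earlier j′ (≤-<-trans d′≤t t<d))
            (slotsBefore-mono S (≤-trans (*-monoˡ-≤ N′ d′≤t) (m≤m+n _ i)) j′))

      -- The condition `4 * Λ ≤ K ^ k` makes the fraction `1 / K ^ k` of a window of length at most
      -- `4 * len j` fit into the laxity.
      overloaded≤slack : ∀ j l → 2 ^ l ≤ 4 * len j → ∑< (2 ^ l) (λ τ → 𝟙 (overloaded? k (2 ^ l) (r j + τ))) ≤ slack j
      overloaded≤slack j l 2^l≤ = *-cancelˡ-≤ (K ^ k) {{m^n≢0 K k}} $ begin
        K ^ k * ∑< (2 ^ l) (λ τ → 𝟙 (overloaded? k (2 ^ l) (r j + τ)))  ≤⟨ overloaded-rare k l (r j) ⟩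
        2 ^ l                  ≤⟨ 2^l≤ ⟩
        4 * len j              ≤⟨ *-monoʳ-≤ 4 (len≤Λ*slack j) ⟩
        4 * (Λ * slack j)      ≡⟨ *-assoc 4 Λ (slack j) ⟨
        4 * Λ * slack j        ≤⟨ *-monoˡ-≤ (slack j) 4*Λ≤K^k ⟩
        K ^ k * slack j        ∎
        where open ≤-Reasoning

      -- If `j` were incomplete, it would run throughout every unit of its lifespan that is not
      -- overloaded. At most `slack j` units are overloaded, and the others suffice for its size.
      completes : ∀ j → (∀ j′ → d j′ < d j → Completed S J (d j′ * N′) j′) → Completed S J (d j * N′) j
      completes j earlier with p j * N′ ≤? slotsBefore S (d j * N′) j
      ... | yes completed = completed
      -- The window must admit the lifespans of competing jobs, up to `2 * len j`; rounding doubles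
      -- this again, whence the 4 in `4 * Λ`.
      ... | no incomplete with 2^-between (2 * len j) {{m*n≢0 2 (len j) {{_}} {{>-nonZero (m<n⇒0<n∸m (release<deadline (J j)))}}}}
      ...   | l , 2len≤2^l , 2^l≤ = begin
        p j * N′
          ≤⟨ ≤-by 0 total (trans (arith (p j) (slack j) N′ (∑< (len j) (λ τ → unitWork S j (r j + τ)))) (cong (λ x → ∑< (len j) (λ τ → unitWork S j (r j + τ)) + N′ * x) (size+slack j))) ⟩
        ∑< (len j) (λ τ → unitWork S j (r j + τ))
          ≤⟨ m≤n+m _ _ ⟩
        ∑< (r j) (unitWork S j) + ∑< (len j) (λ τ → unitWork S j (r j + τ))
          ≡⟨ ∑<-split (r j) (len j) (unitWork S j) ⟨
        ∑< (r j + len j) (unitWork S j)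
          ≡⟨ cong (λ x → ∑< x (unitWork S j)) (r+len j) ⟩
        ∑< (d j) (unitWork S j)
          ≡⟨ slotsBefore-unitWork S (d j) j ⟨
        slotsBefore S (d j * N′) j ∎
        where
        open ≤-Reasoning
        O : ℕ → ℕ
        O t = 𝟙 (overloaded? k (2 ^ l) t)
        arith : ∀ p s N u → p * N + (u + N * s) + 0 ≡ u + N * (p + s)
        arith = solve-∀
        len≤2^l : len j ≤ 2 ^ l
        len≤2^l = ≤-trans (m≤n*m (len j) 2) 2len≤2^l
        slot : ∀ t i → Alive t j → i < N′ → 1 ≤ 𝟙 (runs? S (t * N′ + i) j) + O t
        slot t i alive i<N′ = [ (λ runs → ≤-trans (𝟙-yes (runs? S (t * N′ + i) j) runs) (m≤m+n _ _))
          , (λ idle → ≤-trans (𝟙-yes (overloaded? k (2 ^ l) t) (idle⇒overloaded {l} {j} 2len≤2^l earlier alive i<N′ incomplete idle)) (m≤n+m _ _)) ]′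
          (toSum (runs? S (t * N′ + i) j))
        unit : ∀ t → Alive t j → N′ ≤ unitWork S j t + N′ * O t
        unit t alive = begin
          N′                                                     ≡⟨ *-identityʳ N′ ⟨
          N′ * 1                                                 ≡⟨ ∑<-const N′ 1 ⟨
          ∑< N′ (λ _ → 1)                                        ≤⟨ ∑<-mono N′ (λ i i<N′ → slot t i alive i<N′) ⟩
          ∑< N′ (λ i → 𝟙 (runs? S (t * N′ + i) j) + O t)         ≡⟨ ∑<-distrib-+ N′ _ _ ⟩
          unitWork S j t + ∑< N′ (λ _ → O t)                     ≡⟨ cong (unitWork S j t +_) (∑<-const N′ (O t)) ⟩
          unitWork S j t + N′ * O t                              ∎
        total : N′ * len j ≤ ∑< (len j) (λ τ → unitWork S j (r j + τ)) + N′ * slack j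
        total = begin
          N′ * len j
            ≡⟨ *-comm N′ (len j) ⟩
          len j * N′
            ≡⟨ ∑<-const (len j) N′ ⟨
          ∑< (len j) (λ _ → N′)
            ≤⟨ ∑<-mono (len j) (λ τ τ<len → unit (r j + τ) (m≤m+n (r j) τ , subst (r j + τ <_) (r+len j) (+-monoʳ-< (r j) τ<len))) ⟩
          ∑< (len j) (λ τ → unitWork S j (r j + τ) + N′ * O (r j + τ))
            ≡⟨ ∑<-distrib-+ (len j) _ _ ⟩
          ∑< (len j) (λ τ → unitWork S j (r j + τ)) + ∑< (len j) (λ τ → N′ * O (r j + τ))
            ≡⟨ cong (∑< (len j) (λ τ → unitWork S j (r j + τ)) +_) (*-distribˡ-∑< (len j) N′ _) ⟨
          ∑< (len j) (λ τ → unitWork S j (r j + τ)) + N′ * ∑< (len j) (λ τ → O (r j + τ))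
            ≤⟨ +-monoʳ-≤ (∑< (len j) (λ τ → unitWork S j (r j + τ))) (*-monoʳ-≤ N′ (≤-trans (∑<-monoˡ len≤2^l _) (overloaded≤slack j l (≤-trans 2^l≤ (≤-reflexive (sym (*-assoc 2 2 (len j)))))))) ⟩
          ∑< (len j) (λ τ → unitWork S j (r j + τ)) + N′ * slack j ∎

      -- Strong induction on the deadline, with `x` as a structurally decreasing bound.
      completed-by : ∀ x j → d j < x → Completed S J (d j * N′) j
      completed-by (suc x) j (s≤s d≤x) = completes j λ j′ d′<d → completed-by x j′ (<-≤-trans d′<d d≤x)

    sjf-feasible : Feasible J S
    sjf-feasible j = (λ q → starts-after-release) , completed-by (suc (d j)) j ≤-refl

-- Existence of an SJF schedule

shortest : ∀ {n} (size : Fin n → ℕ) {P : Fin n → Set} → (∀ j → Dec (P j)) →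
  (∃[ j ] P j × ∀ j′ → P j′ → size j ≤ size j′) ⊎ (∀ j → ¬ P j)
shortest {zero}  size P? = inj₂ λ ()
shortest {suc n} size P? with P? zero | shortest (size ∘ suc) (P? ∘ suc)
... | no ¬p | inj₂ none          = inj₂ λ { zero → ¬p ; (suc j) → none j }
... | yes p | inj₂ none          = inj₁ (zero , p , λ { zero _ → ≤-refl ; (suc j) q → contradiction q (none j) })
... | no ¬p | inj₁ (j , q , min) = inj₁ (suc j , q , λ { zero p → contradiction p ¬p ; (suc j′) → min j′ })
... | yes p | inj₁ (j , q , min) with size zero ≤? size (suc j)
...   | yes s≤ = inj₁ (zero , p , λ { zero _ → ≤-refl ; (suc j′) q′ → ≤-trans s≤ (min j′ q′) })
...   | no s≰  = inj₁ (suc j , q , λ { zero _ → <⇒≤ (≰⇒> s≰) ; (suc j′) → min j′ })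

record Selection {n} (size : Fin n → ℕ) (M : ℕ) (P : Fin n → Set) : Set where
  field
    choice    : Fin M → Maybe (Fin n)
    injective : ∀ {i i′ j} → choice i ≡ just j → choice i′ ≡ just j → i ≡ i′
    sound     : ∀ {i j} → choice i ≡ just j → P j
    greedy    : ∀ j → P j → ¬ (∃[ i ] choice i ≡ just j) → ∀ i → ∃[ j′ ] choice i ≡ just j′ × size j′ ≤ size j

open Selection

-- Machines take a shortest remaining candidate in turn. Once none remains the others stay idle, and
-- `greedy` holds vacuously there.
select : ∀ {n} (size : Fin n → ℕ) M {P : Fin n → Set} → (∀ j → Dec (P j)) → Selection size M P
select size zero        P? = record { choice = λ () ; injective = λ { {()} } ; sound = λ { {()} } ; greedy = λ _ _ _ () }
select size (suc M) {P} P? with shortest size P?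
... | inj₂ none = record
  { choice = λ _ → nothing ; injective = λ () ; sound = λ () ; greedy = λ j p → contradiction p (none j) }
... | inj₁ (j₀ , p₀ , min) = record { choice = choose ; injective = inj ; sound = λ {i} → snd {i} ; greedy = grd }
  where
  rest = select size M λ j → P? j ×-dec ¬? (j ≟ᶠ j₀)
  choose : Fin (suc M) → Maybe (Fin _)
  choose zero    = just j₀
  choose (suc i) = choice rest i
  inj : ∀ {i i′ j} → choose i ≡ just j → choose i′ ≡ just j → i ≡ i′
  inj {zero}  {zero}   _ _    = refl
  inj {zero}  {suc i′} refl b = contradiction refl (proj₂ (sound rest b))
  inj {suc i} {zero}   a refl = contradiction refl (proj₂ (sound rest a))
  inj {suc i} {suc i′} a b    = cong suc (injective rest a b)
  snd : ∀ {i j} → choose i ≡ just j → P j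
  snd {zero}  refl = p₀
  snd {suc i} a    = proj₁ (sound rest a)
  grd : ∀ j → P j → ¬ (∃[ i ] choose i ≡ just j) → ∀ i → ∃[ j′ ] choose i ≡ just j′ × size j′ ≤ size j
  grd j p unchosen zero    = j₀ , refl , min j p
  grd j p unchosen (suc i) = greedy rest j (p , λ { refl → unchosen (zero , refl) })
                               (λ (i′ , eq) → unchosen (suc i′ , eq)) i

module _ {n} (J : Instance n) (M : ℕ) where

  private
    -- The factors `* 1` are the resolution of `sjfSchedule`, so that this matches the availability
    -- in `SJF`.
    Pending : ℕ → (Fin n → ℕ) → Fin n → Set
    Pending k done j = release (J j) * 1 ≤ k × ¬ (size (J j) * 1 ≤ done j)

    step : ∀ k done → Selection (λ j → size (J j)) M (Pending k done)
    step k done = select _ M λ j → (release (J j) * 1 ≤? k) ×-dec ¬? (size (J j) * 1 ≤? done j)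

    -- The choice in slot `k` depends on the work done before it, while `slotsBefore` presupposes
    -- the whole schedule. Counting the work alongside the choices breaks this circle.
    done : ℕ → Fin n → ℕ
    done zero    j = 0
    done (suc k) j = if does (any? λ i → ≡-dec _≟ᶠ_ (choice (step k (done k)) i) (just j)) then suc (done k j) else done k j

  sjfSchedule : Schedule n M
  sjfSchedule = record
    { resolution        = 1
    ; assign            = λ k → choice (step k (done k))
    ; oneMachineAtATime = λ k → injective (step k (done k))
    }

  private
    slotsBefore≡done : ∀ k j → slotsBefore sjfSchedule k j ≡ done k j
    slotsBefore≡done zero    j = refl
    slotsBefore≡done (suc k) j = cong (λ x → if does (runs? sjfSchedule k j) then suc x else x) (slotsBefore≡done k j)

  sjfSchedule-SJF : SJF J sjfSchedule
  sjfSchedule-SJF k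
    = (λ j (i , eq) → let released , ¬completed = sound (step k (done k)) eq in
         released , λ completed → ¬completed (≤-trans completed (≤-reflexive (slotsBefore≡done k j))))
    , (λ j (released , ¬completed) idle → greedy (step k (done k)) j
         (released , λ completed → ¬completed (≤-trans completed (≤-reflexive (sym (slotsBefore≡done k j))))) idle)

-- Rational relative laxities and logarithms

open import Data.Integer.Base using (+_; -[1+_]; +[1+_])

-- `i ℚ./ n` is reduced to lowest terms; unnormalised rationals give the cross-multiplied inequality
-- for the original `i` and `n`.
≤-/⁻ : ∀ q i n {{_ : NonZero n}} → q ℚ.≤ i ℚ./ n → ↥ q ℤ.* + n ℤ.≤ i ℤ.* ↧ q
≤-/⁻ q@record{} i (suc n-1) q≤ = ℚᵘ.drop-*≤* (ℚᵘ.≤-respʳ-≃ (ℚ.toℚᵘ-fromℚᵘ (mkℚᵘ i n-1)) (ℚ.toℚᵘ-mono-≤ q≤))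

/-≤⁻ : ∀ q i n {{_ : NonZero n}} → i ℚ./ n ℚ.≤ q → i ℤ.* ↧ q ℤ.≤ ↥ q ℤ.* + n
/-≤⁻ q@record{} i (suc n-1) ≤q = ℚᵘ.drop-*≤* (ℚᵘ.≤-respˡ-≃ (ℚ.toℚᵘ-fromℚᵘ (mkℚᵘ i n-1)) (ℚ.toℚᵘ-mono-≤ ≤q))

ι : ℕ → ℚ
ι x = + x ℚ./ 1

toℚᵘ-ι : ∀ x → toℚᵘ (ι x) ℚᵘ.≃ mkℚᵘ (+ x) 0
toℚᵘ-ι x = ℚ.toℚᵘ-fromℚᵘ (mkℚᵘ (+ x) 0)

ι-homo-* : ∀ x y → ι (x * y) ≡ ι x ℚ.* ι y
ι-homo-* x y = ℚ.toℚᵘ-injective (begin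
  toℚᵘ (ι (x * y))                                ≈⟨ toℚᵘ-ι (x * y) ⟩
  mkℚᵘ (+ (x * y)) 0                              ≡⟨ cong (λ z → mkℚᵘ z 0) (ℤ.pos-* x y) ⟩
  mkℚᵘ (+ x) 0 ℚᵘ.* mkℚᵘ (+ y) 0      ≈⟨ ℚᵘ.*-cong (toℚᵘ-ι x) (toℚᵘ-ι y) ⟨
  toℚᵘ (ι x) ℚᵘ.* toℚᵘ (ι y)          ≈⟨ ℚ.toℚᵘ-homo-* (ι x) (ι y) ⟨
  toℚᵘ (ι x ℚ.* ι y)                              ∎)
  where open import Relation.Binary.Reasoning.Setoid ℚᵘ.≃-setoid

ι-homo-^ : ∀ x n → ι (x ^ n) ≡ ι x ^ℚ n
ι-homo-^ x zero    = refl
ι-homo-^ x (suc n) = trans (ι-homo-* x (x ^ n)) (cong (ι x ℚ.*_) (ι-homo-^ x n))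

^-nonNeg : ∀ {p} n → ℚ.NonNegative p → ℚ.NonNegative (p ^ℚ n)
^-nonNeg zero    _   = _
^-nonNeg {p} (suc n) p≥0 = ℚ.nonNeg*nonNeg⇒nonNeg p {{p≥0}} (p ^ℚ n) {{^-nonNeg n p≥0}}

^-monoˡ : ∀ {p q} n → ℚ.NonNegative p → p ℚ.≤ q → (p ^ℚ n) ℚ.≤ (q ^ℚ n)
^-monoˡ zero    _   _   = ℚ.≤-refl
^-monoˡ {p} {q} (suc n) p≥0 p≤q = ℚ.≤-trans
  (ℚ.*-monoʳ-≤-nonNeg (p ^ℚ n) {{^-nonNeg n p≥0}} p≤q)
  (ℚ.*-monoˡ-≤-nonNeg q {{ℚ.nonNegative (ℚ.≤-trans (ℚ.nonNegative⁻¹ p {{p≥0}}) p≤q)}} (^-monoˡ n p≥0 p≤q))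

log-between : ∀ K → 2 ≤ K → ∀ x {{_ : NonZero x}} → ∃[ e ] K ^ e ≤ x × x < K ^ suc e
log-between K 2≤K (suc zero) = 0 , ≤-refl , ≤-trans 2≤K (≤-reflexive (sym (*-identityʳ K)))
log-between K 2≤K (suc x@(suc _)) with log-between K 2≤K x
... | e , ≤x , x< with suc x <? K ^ suc e
...   | yes 1+x< = e , m≤n⇒m≤1+n ≤x , 1+x<
...   | no 1+x≮  = suc e , ≮⇒≥ 1+x≮ , ≤-<-trans x< (m<n*m (K ^ suc e) K {{m^n≢0 K (suc e) {{>-nonZero (≤-trans (s≤s z≤n) 2≤K)}}}} 2≤K)
  where
  m<n*m : ∀ m n {{_ : NonZero m}} → 2 ≤ n → m < n * m
  m<n*m m n 2≤n = ≤-trans (m<m*n m n 2≤n) (≤-reflexive (*-comm m n))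

m<[1+m/n]*n : ∀ m n {{_ : NonZero n}} → m < suc (m / n) * n
m<[1+m/n]*n m n = ≤-trans (s≤s (≤-reflexive (m≡m%n+[m/n]*n m n))) (+-monoˡ-≤ (m / n * n) (m%n<n m n))

≤-/ : ∀ {x m} n {{_ : NonZero n}} → x * n ≤ m → x ≤ m / n
≤-/ {x} {m} n xn≤m = ≤-trans (≤-reflexive (sym (m*n/n≡m x n))) (/-monoˡ-≤ n xn≤m)

-- Powers of `K` replace logarithms: `x ^ c ≤ K ^ (2 * c) = K ^ (e * C) ≤ y ^ C`, for `x = 1 /
-- λ₂` and `y = 1 / λ₁`.
log-bound : ∀ {x y : ℚ} {K e c C} → ℚ.NonNegative x → x ℚ.≤ ι (K * K) → ι (K ^ e) ℚ.≤ y → 2 * c ≡ e * C →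
            (x ^ℚ c) ℚ.≤ (y ^ℚ C)
log-bound {x} {y} {K} {e} {c} {C} x≥0 x≤ ≤y eq = begin
  x ^ℚ c              ≤⟨ ^-monoˡ c x≥0 x≤ ⟩
  ι (K * K) ^ℚ c      ≡⟨ ι-homo-^ (K * K) c ⟨
  ι ((K * K) ^ c)     ≡⟨ cong ι powers ⟩
  ι ((K ^ e) ^ C)     ≡⟨ ι-homo-^ (K ^ e) C ⟩
  ι (K ^ e) ^ℚ C      ≤⟨ ^-monoˡ C (ℚ.normalize-nonNeg (K ^ e) 1) ≤y ⟩
  y ^ℚ C              ∎
  where
  open ℚ.≤-Reasoning
  powers : (K * K) ^ c ≡ (K ^ e) ^ C
  powers = trans (cong (_^ c) (cong (K *_) (sym (*-identityʳ K)))) (trans (^-*-assoc K 2 c) (trans (cong (K ^_) eq) (sym (^-*-assoc K e C))))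

-- With `p = λ₂` and `q = λ₁` this says that `1 + log_b (λ₂ / λ₁)` is `log_b (1 / λ₁)` in base
-- `b = 1 / λ₂`.
[1/p]*[p÷q]≡1/q : ∀ p q {{_ : ℚ.NonZero p}} {{_ : ℚ.NonZero q}} → 1/ p ℚ.* (p ÷ q) ≡ 1/ q
[1/p]*[p÷q]≡1/q p q = trans (sym (ℚ.*-assoc (1/ p) p (1/ q))) (trans (cong (ℚ._* 1/ q) (ℚ.*-inverseˡ p)) (ℚ.*-identityˡ (1/ q)))

-- Applied to the laxity, which is positive because `λ₁` is; from there on it is a natural number.
positive-factor : ∀ x {{_ : NonZero x}} i b {{_ : NonZero b}} → + x ℤ.≤ i ℤ.* + b → ∃[ s ] i ≡ +[1+ s ]
positive-factor x         +[1+ s ] b       _  = s , refl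
positive-factor (suc x)   (+ zero) (suc b) (ℤ.+≤+ ())
positive-factor (suc x)   -[1+ s ] (suc b) ()

len≡size+laxity : ∀ j {s} → laxity j ≡ + s → size j + s ≡ lifespanLength j
len≡size+laxity j {s} eq = ℤ.+-injective (begin
  + size j ℤ.+ + s                                             ≡⟨ cong (λ x → + size j ℤ.+ x) eq ⟨
  + size j ℤ.+ (+ deadline j ℤ.- + release j ℤ.- + size j)
    ≡⟨ ℤ.+-comm (+ size j) (+ deadline j ℤ.- + release j ℤ.- + size j) ⟩
  + deadline j ℤ.- + release j ℤ.- + size j ℤ.+ + size j
    ≡⟨ ℤ.+-assoc (+ deadline j ℤ.- + release j) (ℤ.- + size j) (+ size j) ⟩
  + deadline j ℤ.- + release j ℤ.+ (ℤ.- + size j ℤ.+ + size j)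
    ≡⟨ cong (λ x → + deadline j ℤ.- + release j ℤ.+ x) (ℤ.+-inverseˡ (+ size j)) ⟩
  + deadline j ℤ.- + release j ℤ.+ + 0                         ≡⟨ ℤ.+-identityʳ _ ⟩
  + deadline j ℤ.- + release j                                 ≡⟨ ℤ.m-n≡m⊖n (deadline j) (release j) ⟩
  deadline j ℤ.⊖ release j                                     ≡⟨ ℤ.⊖-≥ (<⇒≤ (release<deadline j)) ⟩
  + lifespanLength j                                           ∎)
  where open ≡-Reasoning

-- The two numerical hypotheses are `K ≤ 1 / λ₂` and `1 / λ₁ ≤ Λ` with denominators cleared.
job-bounds : ∀ {a₁ b₁ a₂ b₂ K Λ} .{cop₁ : Coprime (suc a₁) (suc b₁)} .{cop₂ : Coprime (suc a₂) (suc b₂)} j →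
  RelLaxityIn (mkℚ +[1+ a₁ ] b₁ cop₁) (mkℚ +[1+ a₂ ] b₂ cop₂) j →
  K * suc a₂ ≤ suc b₂ → suc b₁ ≤ Λ * suc a₁ →
  ∃[ s ] size j + s ≡ lifespanLength j × K * s ≤ lifespanLength j × lifespanLength j ≤ Λ * s × NonZero s
job-bounds {a₁} {b₁} {a₂} {b₂} {K} {Λ} {cop₁} {cop₂} j (λ₁≤ , ≤λ₂) K≤ ≤Λ = suc s , len≡size+laxity j eq , upper , lower , _
  where
  open ≤-Reasoning
  len = lifespanLength j
  instance
    len≢0 : NonZero len
    len≢0 = >-nonZero (m<n⇒0<n∸m (release<deadline j))
  low : + (suc a₁ * len) ℤ.≤ laxity j ℤ.* +[1+ b₁ ]
  low = subst (ℤ._≤ laxity j ℤ.* +[1+ b₁ ]) (sym (ℤ.pos-* (suc a₁) len)) (≤-/⁻ (mkℚ +[1+ a₁ ] b₁ cop₁) (laxity j) len λ₁≤)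
  s+ = positive-factor (suc a₁ * len) {{m*n≢0 (suc a₁) len}} (laxity j) (suc b₁) low
  s = proj₁ s+
  eq = proj₂ s+
  low′ : suc a₁ * len ≤ suc s * suc b₁
  low′ = ℤ.drop‿+≤+ (subst (+ (suc a₁ * len) ℤ.≤_) (trans (cong (ℤ._* +[1+ b₁ ]) eq) (sym (ℤ.pos-* (suc s) (suc b₁)))) low)
  high′ : suc s * suc b₂ ≤ suc a₂ * len
  high′ = ℤ.drop‿+≤+ (subst₂ ℤ._≤_ (trans (cong (ℤ._* +[1+ b₂ ]) eq) (sym (ℤ.pos-* (suc s) (suc b₂)))) (sym (ℤ.pos-* (suc a₂) len))
            (/-≤⁻ (mkℚ +[1+ a₂ ] b₂ cop₂) (laxity j) len ≤λ₂))
  arith₁ : ∀ a K s → a * (K * s) ≡ s * (K * a)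
  arith₁ = solve-∀
  arith₂ : ∀ s L a → s * (L * a) ≡ a * (L * s)
  arith₂ = solve-∀
  upper : K * suc s ≤ len
  upper = *-cancelˡ-≤ (suc a₂) (begin
    suc a₂ * (K * suc s)   ≡⟨ arith₁ (suc a₂) K (suc s) ⟩
    suc s * (K * suc a₂)   ≤⟨ *-monoʳ-≤ (suc s) K≤ ⟩
    suc s * suc b₂         ≤⟨ high′ ⟩
    suc a₂ * len           ∎)
  lower : len ≤ Λ * suc s
  lower = *-cancelˡ-≤ (suc a₁) (begin
    suc a₁ * len           ≤⟨ low′ ⟩
    suc s * suc b₁         ≤⟨ *-monoʳ-≤ (suc s) ≤Λ ⟩
    suc s * (Λ * suc a₁)   ≡⟨ arith₂ (suc s) Λ (suc a₁) ⟩
    suc a₁ * (Λ * suc s)   ∎)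

-- Machine optimality in terms of `K`, `Λ` and `k`, and the choice of these

no-machines : ∀ {n} {J : Instance n} {S : Schedule n 0} → Feasible J S → ∀ j → size (J j) ≡ 0
no-machines {J = J} {S} feasible j = n≤0⇒n≡0 (*-cancelʳ-≤ (size (J j)) 0 (resolution S) (begin
  size (J j) * resolution S                        ≤⟨ proj₂ (feasible j) ⟩
  slotsBefore S D j                                ≡⟨ slotsBefore-∑< S D j ⟩
  ∑< D (λ q → 𝟙 (runs? S q j))                     ≡⟨ ∑<-cong D (λ q _ → 𝟙-no (runs? S q j) λ ()) ⟩
  ∑< D (λ _ → 0)                                   ≡⟨ ∑<-const D 0 ⟩
  D * 0                                            ≡⟨ *-zeroʳ D ⟩
  0                                                ∎))
  where
  open ≤-Reasoning
  D = deadline (J j) * resolution S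

sjf-machineOptimal : ∀ {P : Job → Set} K Λ k → 2 ≤ K → 4 * Λ ≤ K ^ k →
  (∀ j → P j → ∃[ s ] size j + s ≡ lifespanLength j × K * s ≤ lifespanLength j × lifespanLength j ≤ Λ * s × NonZero s) →
  MachineOptimal SJF P (63 * k)
sjf-machineOptimal K Λ k 2≤K 4Λ≤K^k bounds {n} J P m (S₀ , feasible) =
  (sjfSchedule J (63 * k * m) , sjfSchedule-SJF J (63 * k * m)) , sjf-runs m S₀ feasible
  where
  slack : Fin n → ℕ
  slack j = proj₁ (bounds (J j) (P j))
  size+slack : ∀ j → size (J j) + slack j ≡ lifespanLength (J j)
  size+slack j = proj₁ (proj₂ (bounds (J j) (P j)))
  K*slack≤len : ∀ j → K * slack j ≤ lifespanLength (J j)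
  K*slack≤len j = proj₁ (proj₂ (proj₂ (bounds (J j) (P j))))
  len≤Λ*slack : ∀ j → lifespanLength (J j) ≤ Λ * slack j
  len≤Λ*slack j = proj₁ (proj₂ (proj₂ (proj₂ (bounds (J j) (P j)))))
  slack≢0 : ∀ j → NonZero (slack j)
  slack≢0 j = proj₂ (proj₂ (proj₂ (proj₂ (bounds (J j) (P j)))))
  size≢0 : ∀ j → ¬ size (J j) ≡ 0
  size≢0 j size≡0 = <⇒≱ (m<m*n (slack j) K {{slack≢0 j}} 2≤K) (begin
    slack j * K              ≡⟨ *-comm (slack j) K ⟩
    K * slack j              ≤⟨ K*slack≤len j ⟩
    lifespanLength (J j)     ≡⟨ size+slack j ⟨
    size (J j) + slack j     ≡⟨ cong (_+ slack j) size≡0 ⟩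
    slack j                  ∎)
    where open ≤-Reasoning
  sjf-runs : ∀ m (S₀ : Schedule n m) → Feasible J S₀ → ∀ (S : Schedule n (63 * k * m)) → SJF J S → Feasible J S
  -- Without machines all sizes would be 0, but `2 ≤ K` and nonzero laxity force positive sizes; so
  -- there is no job.
  sjf-runs zero      S₀ feasible S _ j = contradiction (no-machines {J = J} {S₀} feasible j) (size≢0 j)
  sjf-runs m@(suc _) S₀ feasible S sjf =
    sjf-feasible J K {{>-nonZero (≤-trans (s≤s z≤n) 2≤K)}} 2≤K slack size+slack K*slack≤len slack≢0 S₀ feasible
      k Λ 4Λ≤K^k len≤Λ*slack S sjf

relLaxity-machineOptimal : ∀ {λ₁ λ₂} .{{_ : ℚ.Positive λ₁}} .{{_ : ℚ.Positive λ₂}} → λ₁ ℚ.≤ λ₂ → λ₂ ℚ.≤ ½ →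
  ∃[ K ] ∃[ e ] (1/ λ₂) {{ℚ.pos⇒nonZero λ₂}} ℚ.≤ ι (K * K) × ι (K ^ e) ℚ.≤ (1/ λ₁) {{ℚ.pos⇒nonZero λ₁}}
    × MachineOptimal SJF (RelLaxityIn λ₁ λ₂) (63 * (4 * e))
relLaxity-machineOptimal {mkℚ +[1+ a₁ ] b₁ cop₁} {mkℚ +[1+ a₂ ] b₂ cop₂} (*≤* λ₁≤λ₂) (*≤* λ₂≤½) =
  -- `Λ = K ^ (1 + e)` exceeds `1 / λ₁`, and `k = 4 * e` suffices: `4 ≤ K * K` and `e ≥ 1` give
  -- `4 * Λ ≤ K ^ (3 + e) ≤ K ^ (4 * e)`.
  K , e , x≤ , ≤y , sjf-machineOptimal K (K ^ suc e) (4 * e) 2≤K (4Λ≤ e e≢0)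
    (λ j rel → job-bounds {K = K} {K ^ suc e} {cop₁ = cop₁} {cop₂ = cop₂} j rel (m/n*n≤m (suc b₂) (suc a₂)) (<⇒≤ b₁<))
  where
  open ≤-Reasoning
  -- K = ⌊1/λ₂⌋ and L = ⌊1/λ₁⌋, with K ^ e ≤ L < K ^ (1 + e)
  K = suc b₂ / suc a₂
  L = suc b₁ / suc a₁
  2≤K : 2 ≤ K
  2≤K = ≤-/ (suc a₂) (≤-trans (≤-reflexive (*-comm 2 (suc a₂))) (≤-trans (ℤ.drop‿+≤+ λ₂≤½) (≤-reflexive (*-identityˡ (suc b₂)))))
  instance
    K≢0 : NonZero K
    K≢0 = >-nonZero (≤-trans (s≤s z≤n) 2≤K)
  K≤L : K ≤ L
  K≤L = ≤-/ (suc a₁) (*-cancelˡ-≤ (suc a₂) (begin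
    suc a₂ * (K * suc a₁)     ≡⟨ arith (suc a₂) K (suc a₁) ⟩
    suc a₁ * (K * suc a₂)     ≤⟨ *-monoʳ-≤ (suc a₁) (m/n*n≤m (suc b₂) (suc a₂)) ⟩
    suc a₁ * suc b₂           ≤⟨ ℤ.drop‿+≤+ λ₁≤λ₂ ⟩
    suc a₂ * suc b₁           ∎))
    where
    arith : ∀ x y z → x * (y * z) ≡ z * (y * x)
    arith = solve-∀
  logarithm = log-between K 2≤K L {{>-nonZero (≤-trans (s≤s z≤n) (≤-trans 2≤K K≤L))}}
  e = proj₁ logarithm
  K^e≤L = proj₁ (proj₂ logarithm)
  L<K^[1+e] = proj₂ (proj₂ logarithm)
  e≢0 : ¬ e ≡ 0
  e≢0 e≡0 = <⇒≱ L<K^[1+e] (begin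
    K ^ suc e   ≡⟨ cong (λ x → K ^ suc x) e≡0 ⟩
    K * 1       ≡⟨ *-identityʳ K ⟩
    K           ≤⟨ K≤L ⟩
    L           ∎)
  b₁< : suc b₁ < K ^ suc e * suc a₁
  b₁< = <-≤-trans (m<[1+m/n]*n (suc b₁) (suc a₁)) (*-monoˡ-≤ (suc a₁) L<K^[1+e])
  4Λ≤ : ∀ e → ¬ e ≡ 0 → 4 * K ^ suc e ≤ K ^ (4 * e)
  4Λ≤ zero     e≢0 = contradiction refl e≢0
  4Λ≤ (suc e′) _   = begin
    4 * K ^ suc (suc e′)          ≤⟨ *-monoˡ-≤ (K ^ suc (suc e′)) (*-mono-≤ 2≤K 2≤K) ⟩
    K * K * K ^ suc (suc e′)      ≡⟨ *-assoc K K _ ⟩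
    K ^ (4 + e′)
      ≤⟨ ^-monoʳ-≤ K (≤-trans (+-monoʳ-≤ 4 (m≤n*m e′ 4)) (≤-reflexive (sym (*-suc 4 e′)))) ⟩
    K ^ (4 * suc e′)              ∎
  -- `1 / λ₂ < K + 1 ≤ K * K`: rounding down to `K` costs a factor 2 in the logarithm.
  x≤ : mkℚ +[1+ b₂ ] a₂ _ ℚ.≤ ι (K * K)
  x≤ = ℚ.toℚᵘ-cancel-≤ (ℚᵘ.≤-respʳ-≃ (ℚᵘ.≃-sym (toℚᵘ-ι (K * K)))
    (ℚᵘ.*≤* (subst₂ ℤ._≤_ (sym (ℤ.*-identityʳ +[1+ b₂ ])) (ℤ.pos-* (K * K) (suc a₂)) (ℤ.+≤+ (begin
      suc b₂            ≤⟨ <⇒≤ (m<[1+m/n]*n (suc b₂) (suc a₂)) ⟩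
      suc K * suc a₂    ≤⟨ *-monoˡ-≤ (suc a₂) (m<m*n K K 2≤K) ⟩
      K * K * suc a₂    ∎)))))
  ≤y : ι (K ^ e) ℚ.≤ mkℚ +[1+ b₁ ] a₁ _
  ≤y = ℚ.toℚᵘ-cancel-≤ (ℚᵘ.≤-respˡ-≃ (ℚᵘ.≃-sym (toℚᵘ-ι (K ^ e)))
    (ℚᵘ.*≤* (subst₂ ℤ._≤_ (ℤ.pos-* (K ^ e) (suc a₁)) (sym (ℤ.*-identityʳ +[1+ b₁ ])) (ℤ.+≤+ (begin
      K ^ e * suc a₁    ≤⟨ *-monoˡ-≤ (suc a₁) K^e≤L ⟩
      L * suc a₁        ≤⟨ m/n*n≤m (suc b₁) (suc a₁) ⟩
      suc b₁            ∎)))))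

lemma1 :
  ∃[ C ] ∀ (λ₁ λ₂ : ℚ) .{{_ : Positive λ₁}} .{{_ : Positive λ₂}} → λ₁ ℚ.≤ λ₂ → λ₂ ℚ.≤ ½ →
    ∃[ c ] (c ≤ C ·[1+log[ (1/ λ₂) {{pos⇒nonZero λ₂}} ] ((λ₂ ÷ λ₁) {{pos⇒nonZero λ₁}}) ])
         × MachineOptimal SJF (RelLaxityIn λ₁ λ₂) c
-- `504 = 2 * 63 * 4`, from `63 * k` with `k = 4 * e` and the bound `1 / λ₂ ≤ K * K`.
lemma1 = 504 , λ λ₁ λ₂ λ₁≤λ₂ λ₂≤½ →
  let K , e , 1/λ₂≤K² , K^e≤1/λ₁ , optimal = relLaxity-machineOptimal λ₁≤λ₂ λ₂≤½
  in 63 * (4 * e)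
   , subst (λ y → ((1/ λ₂) {{pos⇒nonZero λ₂}} ^ℚ (63 * (4 * e))) ℚ.≤ (y ^ℚ 504))
       (sym ([1/p]*[p÷q]≡1/q λ₂ λ₁ {{pos⇒nonZero λ₂}} {{pos⇒nonZero λ₁}}))
       (log-bound {e = e} {63 * (4 * e)} {504} (pos⇒nonNeg ((1/ λ₂) {{pos⇒nonZero λ₂}}) {{1/pos⇒pos λ₂}}) 1/λ₂≤K² K^e≤1/λ₁ (arith e))
   , optimal
  where
  arith : ∀ e → 2 * (63 * (4 * e)) ≡ e * 504
  arith = solve-∀
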